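{- The property of having o-minimal open core is not elementary.
   Context: "Definable" always means definable with parameters. Let $\mathcal{R}=(R,<,\ldots)$ be a first-order structure expanding a dense linear order without endpoints. Give $R$ the order topology and each $R^n$ the product topology. The open core $\mathcal{R}^{\circ}$ of $\mathcal{R}$ is the structure with universe $R$ whose language consists of a relation symbol for each open set $U\subseteq R^n$, for every $n$, that is definable in $\mathcal{R}$. The structure $\mathcal{R}$ has o-minimal open core if $\mathcal{R}^{\circ}$ is o-minimal, i.e. every subset of $R$ definable in $\mathcal{R}^{\circ}$ is a finite union of points and intervals with endpoints in $R\cup\{ -\infty,+\infty\}$. A property of structures is elementary if it is determined by the first-order theory of the structure, i.e. whenever two structures in the same language are elementarily equivalent and one has the property, so does the other. -}

module Defs where

open import Level using (Level; 0ℓ; Lift) renaming (suc to lsuc)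
open import Data.Empty using (⊥)
open import Data.Fin using (Fin)
open import Data.List using (List)
open import Data.List.Relation.Unary.Any using (Any)
open import Data.Nat using (ℕ; suc; _+_)
open import Data.Product using (Σ; ∃-syntax; _×_; _,_; proj₁)
open import Data.Sum using (_⊎_)
open import Data.Vec using (Vec; []; _∷_; _++_; head; lookup)
open import Function using (_∘_; _⇔_)
open import Relation.Binary using (Rel; IsDenseLinearOrder)
open import Relation.Binary.PropositionalEquality using (_≡_)
import Relation.Binary.Construct.Add.Extrema.Strict as Extrema
open import Relation.Nullary using (¬_)
open import Relation.Nullary.Construct.Add.Extrema using (_±; [_])
open import Relation.Unary using (Pred; _∈_; _⊆_; _≐_)

private variable
  ℓ : Level
  n : ℕ

------------------------------------------------------------------------
-- First-order logic

record Language (ℓ : Level) : Set (lsuc ℓ) where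
  field
    Function : ℕ → Set ℓ
    Relation : ℕ → Set ℓ

open Language

-- Terms and formulas with n free variables, as de Bruijn indices.

data Term (L : Language ℓ) (n : ℕ) : Set ℓ where
  var : Fin n → Term L n
  app : ∀ {k} → Function L k → Vec (Term L n) k → Term L n

infix  7 _≈′_
infixr 6 _∧′_
infixr 5 _∨′_

data Formula (L : Language ℓ) : ℕ → Set ℓ where
  _≈′_      : Term L n → Term L n → Formula L n
  rel       : ∀ {k} → Relation L k → Vec (Term L n) k → Formula L n
  ¬′_       : Formula L n → Formula L n
  _∧′_ _∨′_ : Formula L n → Formula L n → Formula L n
  ∀′_ ∃′_   : Formula L (suc n) → Formula L n

record Structure (L : Language ℓ) : Set (ℓ Level.⊔ lsuc 0ℓ) where
  field
    Carrier  : Set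
    nonempty : Carrier
    ⟦_⟧ᶠ     : ∀ {k} → Function L k → Vec Carrier k → Carrier
    ⟦_⟧ʳ     : ∀ {k} → Relation L k → Pred (Vec Carrier k) 0ℓ

open Structure

module _ {L : Language ℓ} (M : Structure L) where

  mutual
    eval : Term L n → Vec (Carrier M) n → Carrier M
    eval (var i)    v = lookup v i
    eval (app f ts) v = ⟦ M ⟧ᶠ f (evals ts v)

    evals : ∀ {k} → Vec (Term L n) k → Vec (Carrier M) n → Vec (Carrier M) k
    evals []       v = []
    evals (t ∷ ts) v = eval t v ∷ evals ts v

  infix 4 _⊨_[_]

  _⊨_[_] : Formula L n → Vec (Carrier M) n → Set
  _⊨_[_] (s ≈′ t)   v = eval s v ≡ eval t v
  _⊨_[_] (rel r ts) v = ⟦ M ⟧ʳ r (evals ts v)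
  _⊨_[_] (¬′ φ)     v = ¬ _⊨_[_] φ v
  _⊨_[_] (φ ∧′ ψ)   v = _⊨_[_] φ v × _⊨_[_] ψ v
  _⊨_[_] (φ ∨′ ψ)   v = _⊨_[_] φ v ⊎ _⊨_[_] ψ v
  _⊨_[_] (∀′ φ)     v = ∀ x → _⊨_[_] φ (x ∷ v)
  _⊨_[_] (∃′ φ)     v = ∃[ x ] _⊨_[_] φ (x ∷ v)

  -- The vector p holds the parameters.
  Definable : Pred (Vec (Carrier M) n) 0ℓ → Set ℓ
  Definable {n} X =
    ∃[ m ] Σ (Formula L (n + m)) λ φ → Σ (Vec (Carrier M) m) λ p →
      X ≐ λ v → _⊨_[_] φ (v ++ p)

_≡ₑ_ : {L : Language ℓ} → Structure L → Structure L → Set ℓ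
_≡ₑ_ {L = L} M N = (φ : Formula L 0) → (M ⊨ φ [ [] ]) ⇔ (N ⊨ φ [ [] ])

------------------------------------------------------------------------
-- Intervals and the order topology

module Order {A : Set} (_<_ : Rel A 0ℓ) where

  open Extrema _<_ using (_<±_)

  -- The open interval (a , b); A ± is A with -∞ and +∞ added.
  Interval : A ± → A ± → Pred A 0ℓ
  Interval a b x = (a <± [ x ]) × ([ x ] <± b)

  Box : Vec (A ±) n → Vec (A ±) n → Pred (Vec A n) 0ℓ
  Box as bs x = ∀ i → lookup x i ∈ Interval (lookup as i) (lookup bs i)

  -- Open boxes form a basis of the product of the order topologies.
  Open : Pred (Vec A n) 0ℓ → Set
  Open U = ∀ x → x ∈ U → ∃[ as ] ∃[ bs ] (x ∈ Box as bs × Box as bs ⊆ U)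

  data Piece : Set where
    point    : A → Piece
    interval : A ± → A ± → Piece

  ⟦_⟧ : Piece → Pred A 0ℓ
  ⟦ point a ⟧      x = x ≡ a
  ⟦ interval a b ⟧ x = x ∈ Interval a b

  -- Half-open and closed intervals are open intervals together with points,
  -- so open ones suffice.
  FiniteUnion : Pred A 0ℓ → Set
  FiniteUnion X = Σ (List Piece) λ ps → X ≐ λ x → Any (λ p → x ∈ ⟦ p ⟧) ps

-- The order is a separate argument because the language of an open core has
-- no distinguished symbol for it (only the one for the open set x < y).
OMinimal : {L : Language ℓ} (M : Structure L) → Rel (Carrier M) 0ℓ →
           Set (ℓ Level.⊔ lsuc 0ℓ)
OMinimal M _<_ = (X : Pred (Carrier M) 0ℓ) →
  Definable M {n = 1} (X ∘ head) → Order.FiniteUnion _<_ X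

------------------------------------------------------------------------
-- Expansions of dense linear orders without endpoints

record OrderedLanguage : Set₁ where
  field
    language : Language 0ℓ
    less     : Relation language 2

open OrderedLanguage

record DLOExpansion (L : OrderedLanguage) : Set₁ where
  field
    structure : Structure (language L)

  infix 4 _<_

  _<_ : Rel (Carrier structure) 0ℓ
  x < y = ⟦ structure ⟧ʳ (less L) (x ∷ y ∷ [])

  field
    isDenseLinearOrder : IsDenseLinearOrder _≡_ _<_
    no-least           : ∀ x → ∃[ y ] y < x
    no-greatest        : ∀ x → ∃[ y ] x < y

open DLOExpansion

module _ {L : OrderedLanguage} (R : DLOExpansion L) where

  private
    A = Carrier (structure R)

  openCoreLanguage : Language (lsuc 0ℓ)
  openCoreLanguage .Function k = Lift _ ⊥
  openCoreLanguage .Relation k = Σ (Pred (Vec A k) 0ℓ) λ U →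
    Definable (structure R) U × Order.Open (_<_ R) U

  openCore : Structure openCoreLanguage
  openCore .Carrier  = A
  openCore .nonempty = nonempty (structure R)
  openCore .⟦_⟧ᶠ ()
  openCore .⟦_⟧ʳ = proj₁

  HasOMinimalOpenCore : Set₁
  HasOMinimalOpenCore = OMinimal openCore (_<_ R)

-- Elementary equivalence is symmetric, so one implication suffices.
Elementary : (∀ {L} → DLOExpansion L → Set₁) → Set₁
Elementary P = ∀ {L} (R S : DLOExpansion L) →
  structure R ≡ₑ structure S → P R → P S

{-# OPTIONS --safe #-}

-- Let each point p of a countable dense order carry a finite set κ p of points,
-- so generically that every finite set is κ p for densely many p, and let the
-- language name < and x ∈ κ p. Finite order isomorphisms which respect κ form a
-- back-and-forth system, and they approximate all finite order isomorphisms.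
-- Hence an open definable set is invariant under order isomorphisms fixing a
-- finite set, and so the open core defines only finite unions of points and
-- intervals. But the sets κ p are closed, discrete and of unbounded size, so an
-- elementarily equivalent structure has an infinite closed discrete fibre. Such
-- a structure is obtained as an ultrapower restricted to the countably many
-- sequences generated from one sequence by Skolem functions: its ultrafilter
-- only has to decide countably many sets, so excluded middle suffices.

module Submission where

open import Defs
open import Axiom.ExcludedMiddle using (ExcludedMiddle)
open import Axiom.UniquenessOfIdentityProofs.WithK using (uip)
open import Data.Bool using (Bool; true; false)
open import Data.Empty using (⊥; ⊥-elim)
open import Data.Fin using (Fin; zero; suc; toℕ; #_)
open import Data.Fin.Properties using (toℕ-injective)
open import Data.List using (List; []; _∷_; _++_; length; map; replicate)
open import Data.List.Membership.Propositional using (_∈_; _∉_; lose)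
open import Data.List.Membership.Propositional.Properties using (∈-map⁺; ∈-map⁻; ∈-++⁺ˡ; ∈-++⁺ʳ)
import Data.List.Relation.Binary.Pointwise as ListPointwise
open import Data.List.Relation.Binary.Subset.Propositional using (_⊆_)
open import Data.List.Relation.Unary.Any using (Any; here; there)
import Data.List.Relation.Unary.Any.Properties as Any
import Data.Nat as ℕ
open import Data.Nat using (ℕ; zero; suc; _+_; _*_; _⊔_; _≤_; z≤n; s≤s)
open import Data.Nat.Induction using (<-wellFounded)
import Data.Nat.Properties as ℕ
open import Data.Product using (∃; ∃-syntax; _×_; _,_; proj₁; proj₂; swap)
open import Data.Sum using (_⊎_; inj₁; inj₂; [_,_]′)
open import Data.Unit using (⊤; tt)
open import Data.Vec using (Vec; []; _∷_; head; lookup; toList)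
open import Data.Vec.Membership.Propositional.Properties using (∈-toList⁺; ∈-lookup)
import Data.Vec.Relation.Binary.Pointwise.Inductive as VecPointwise
open import Function using (_∘_; id; _⇔_; mk⇔; Equivalence)
import Induction.WellFounded as WellFounded
open import Induction.WellFounded using (WellFounded; Acc; acc)
open import Level using (Level; 0ℓ)
open import Relation.Binary using (Rel; IsEquivalence; IsDenseLinearOrder; IsStrictTotalOrder; Dense; Tri; tri<; tri≈; tri>)
import Relation.Binary.Construct.Add.Extrema.Strict as Extrema
import Relation.Binary.Construct.Flip.EqAndOrd as Flip
import Relation.Binary.Construct.On as On
open import Relation.Binary.PropositionalEquality using (_≡_; refl; sym; trans; cong; cong₂; subst; isEquivalence)
open import Relation.Binary.Structures.Biased using (isStrictTotalOrderᶜ)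
open import Relation.Nullary using (¬_; Dec; yes; no; contradiction)
open import Relation.Nullary.Construct.Add.Extrema using (_±; ⊥±; ⊤±; [_])
open import Relation.Nullary.Decidable using (decidable-stable)
open import Relation.Unary using (Pred)

open VecPointwise using ([]; _∷_)

private variable
  ℓ : Level

-- Dense linear orders and finite partial order isomorphisms.

module Gap {A : Set} {_<_ : Rel A 0ℓ} (isSTO : IsStrictTotalOrder _≡_ _<_)
           (dense : Dense _<_) (unbounded : ∀ x → ∃[ y ] x < y) where

  open IsStrictTotalOrder isSTO using (compare) renaming (trans to <-trans)

  between-both : ∀ {c u e} → c < u → c < e → ∃[ v ] c < v × v < u × v < e
  between-both {c} {u} {e} c<u c<e with compare u e
  ... | tri< u<e _ _ = let v , c<v , v<u = dense c<u in v , c<v , v<u , <-trans v<u u<e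
  ... | tri≈ _ refl _ = let v , c<v , v<u = dense c<u in v , c<v , v<u , v<u
  ... | tri> _ _ e<u = let v , c<v , v<e = dense c<e in v , c<v , <-trans v<e e<u , v<e

  -- A finite set leaves free some interval just above any point. Instantiated at the reversed
  -- order, it also yields the free interval below.
  gap : ∀ c B → ∃[ u ] c < u × (∀ {e} → e ∈ B → c < e → u < e)
  gap c [] = let u , c<u = unbounded c in u , c<u , λ ()
  gap c (e ∷ B) with gap c B | compare c e
  ... | u , c<u , u<B | tri≈ c≮e _ _ =
    u , c<u , λ { (here refl) c<e → contradiction c<e c≮e ; (there e∈B) → u<B e∈B }
  ... | u , c<u , u<B | tri> c≮e _ _ =
    u , c<u , λ { (here refl) c<e → contradiction c<e c≮e ; (there e∈B) → u<B e∈B }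
  ... | u , c<u , u<B | tri< c<e _ _ =
    let v , c<v , v<u , v<e = between-both c<u c<e in
    v , c<v , λ { (here refl) _ → v<e ; (there e∈B) c<e′ → <-trans v<u (u<B e∈B c<e′) }

module DenseOrder {A : Set} {_<_ : Rel A 0ℓ} (isDLO : IsDenseLinearOrder _≡_ _<_)
                  (no-least : ∀ x → ∃[ y ] y < x) (no-greatest : ∀ x → ∃[ y ] x < y) where

  open IsDenseLinearOrder isDLO public
    using (isStrictTotalOrder; irrefl; asym; compare; dense) renaming (trans to <-trans)

  open Gap isStrictTotalOrder dense no-greatest public
    using () renaming (gap to gap-above)

  dense-flip : Dense (λ x y → y < x)
  dense-flip y<x = let z , y<z , z<x = dense y<x in z , z<x , y<z

  open Gap (Flip.isStrictTotalOrder isStrictTotalOrder)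
           dense-flip no-least public
    using () renaming (gap to gap-below)

  Graph : Set
  Graph = List (A × A)

  -- Preserving and reflecting the strict order, in a total order, already makes the graph
  -- functional and injective.
  OrderIso : Graph → Set
  OrderIso σ = ∀ {a b a′ b′} → (a , b) ∈ σ → (a′ , b′) ∈ σ → (a < a′ → b < b′) × (b < b′ → a < a′)

  -- Nothing is asked at pairs whose first entry is `a`, so that the induction in `fits-exists` also
  -- covers an `a` already in the domain.
  Fits : Graph → A → A → Set
  Fits σ a c = ∀ {a′ b′} → (a′ , b′) ∈ σ → (a′ < a → b′ < c) × (a < a′ → c < b′)

  Fixes : List A → Graph → Set
  Fixes F σ = ∀ {f} → f ∈ F → (f , f) ∈ σ

  ∈-swap⁺ : ∀ {a b : A} {σ} → (a , b) ∈ σ → (b , a) ∈ map swap σ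
  ∈-swap⁺ = ∈-map⁺ swap

  ∈-swap⁻ : ∀ {a b : A} {σ} → (a , b) ∈ map swap σ → (b , a) ∈ σ
  ∈-swap⁻ p with ∈-map⁻ swap p
  ... | _ , q , refl = q

  orderIso-swap : ∀ {σ} → OrderIso σ → OrderIso (map swap σ)
  orderIso-swap iso p q = swap (iso (∈-swap⁻ p) (∈-swap⁻ q))

  orderIso-functional : ∀ {σ} → OrderIso σ → ∀ {a b a′ b′} → (a , b) ∈ σ → (a′ , b′) ∈ σ → a ≡ a′ → b ≡ b′
  orderIso-functional iso {b = b} {b′ = b′} p q refl with compare b b′
  ... | tri< b<b′ _ _ = contradiction (proj₂ (iso p q) b<b′) (irrefl refl)
  ... | tri≈ _ b≡b′ _ = b≡b′
  ... | tri> _ _ b′<b = contradiction (proj₂ (iso q p) b′<b) (irrefl refl)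

  orderIso-≡ : ∀ {σ} → OrderIso σ → ∀ {a b a′ b′} → (a , b) ∈ σ → (a′ , b′) ∈ σ → a ≡ a′ ⇔ b ≡ b′
  orderIso-≡ iso p q = mk⇔ (orderIso-functional iso p q)
    (orderIso-functional (orderIso-swap iso) (∈-swap⁺ p) (∈-swap⁺ q))

  orderIso-∷ : ∀ {σ a b} → OrderIso σ → Fits σ a b → (∀ b′ → (a , b′) ∉ σ) → OrderIso ((a , b) ∷ σ)
  orderIso-∷ iso fits new (here refl) (here refl) = ⊥-elim ∘ irrefl refl , ⊥-elim ∘ irrefl refl
  orderIso-∷ {a = a} iso fits new {a′ = a′} {b′} (here refl) (there q) = proj₂ (fits q) , from
    where
    from : _ → a < a′
    from b<b′ with compare a a′
    ... | tri< a<a′ _ _ = a<a′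
    ... | tri≈ _ a≡a′ _ = contradiction (subst (λ x → (x , b′) ∈ _) (sym a≡a′) q) (new _)
    ... | tri> _ _ a′<a = contradiction (proj₁ (fits q) a′<a) (asym b<b′)
  orderIso-∷ {a = a} iso fits new {a′} {b′} (there q) (here refl) = proj₁ (fits q) , from
    where
    from : _ → a′ < a
    from b′<b with compare a′ a
    ... | tri< a′<a _ _ = a′<a
    ... | tri≈ _ a′≡a _ = contradiction (subst (λ x → (x , b′) ∈ _) a′≡a q) (new _)
    ... | tri> _ _ a<a′ = contradiction (proj₂ (fits q) a<a′) (asym b′<b)
  orderIso-∷ iso fits new (there p) (there q) = iso p q

  <-or-below : ∀ b c → b < c ⊎ (∀ {x} → x < c → x < b)
  <-or-below b c with compare b c
  ... | tri< b<c _ _ = inj₁ b<c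
  ... | tri≈ _ refl _ = inj₂ id
  ... | tri> _ _ c<b = inj₂ λ x<c → <-trans x<c c<b

  >-or-above : ∀ b c → c < b ⊎ (∀ {x} → c < x → b < x)
  >-or-above b c with compare b c
  ... | tri< b<c _ _ = inj₂ (<-trans b<c)
  ... | tri≈ _ refl _ = inj₂ id
  ... | tri> _ _ c<b = inj₁ c<b

  -- Induction on the graph. If the value `c` for the tail lies on the wrong side of the new image
  -- `b′`, it is moved just past `b′`, before every other image on that side. The images on the far
  -- side of `a` are already past `b′`, because `σ` is an isomorphism, and those on the near side
  -- are separated from the new value by `b′` or `c`.
  fits-exists : ∀ {σ} → OrderIso σ → ∀ a → ∃[ c ] Fits σ a c
  fits-exists {[]} iso a = a , λ ()
  fits-exists {(a′ , b′) ∷ σ} iso a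
    with fits-exists {σ} (λ p q → iso (there p) (there q)) a | compare a′ a
  ... | c , fits | tri≈ a′≮a _ a≮a′ =
    c , λ { (here refl) → (⊥-elim ∘ a′≮a) , (⊥-elim ∘ a≮a′) ; (there p) → fits p }
  ... | c , fits | tri< a′<a _ a≮a′ with <-or-below b′ c
  ...   | inj₁ b′<c = c , λ { (here refl) → (λ _ → b′<c) , (⊥-elim ∘ a≮a′) ; (there p) → fits p }
  ...   | inj₂ c≤b′ =
    let u , b′<u , u<σ = gap-above b′ (map proj₂ σ) in
    u , λ { (here refl) → (λ _ → b′<u) , (⊥-elim ∘ a≮a′)
          ; (there p) → (λ a″<a → <-trans (c≤b′ (proj₁ (fits p) a″<a)) b′<u)
                      , (λ a<a″ → u<σ (∈-map⁺ proj₂ p) (proj₁ (iso (here refl) (there p)) (<-trans a′<a a<a″))) }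
  fits-exists {(a′ , b′) ∷ σ} iso a
      | c , fits | tri> a′≮a _ a<a′ with >-or-above b′ c
  ...   | inj₁ c<b′ = c , λ { (here refl) → (⊥-elim ∘ a′≮a) , (λ _ → c<b′) ; (there p) → fits p }
  ...   | inj₂ b′≤c =
    let l , l<b′ , σ<l = gap-below b′ (map proj₂ σ) in
    l , λ { (here refl) → (⊥-elim ∘ a′≮a) , (λ _ → l<b′)
          ; (there p) → (λ a″<a → σ<l (∈-map⁺ proj₂ p) (proj₁ (iso (there p) (here refl)) (<-trans a″<a a<a′)))
                      , (λ a<a″ → <-trans l<b′ (b′≤c (proj₂ (fits p) a<a″))) }

  module _ (em : ExcludedMiddle 0ℓ) where

    orderIso-forth : ∀ {σ} → OrderIso σ → ∀ a → ∃[ σ′ ] OrderIso σ′ × σ ⊆ σ′ × ∃[ b ] (a , b) ∈ σ′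
    orderIso-forth {σ} iso a with em {∃[ b ] (a , b) ∈ σ}
    ... | yes (b , p) = σ , iso , id , b , p
    ... | no new = let c , fits = fits-exists iso a in
      (a , c) ∷ σ , orderIso-∷ iso fits (λ b p → new (b , p)) , there , c , here refl

    orderIso-forth-list : ∀ {σ} → OrderIso σ → ∀ as →
      ∃[ σ′ ] OrderIso σ′ × σ ⊆ σ′ × (∀ {a} → a ∈ as → ∃[ b ] (a , b) ∈ σ′)
    orderIso-forth-list iso []       = _ , iso , id , λ ()
    orderIso-forth-list iso (a ∷ as) =
      let σ₁ , iso₁ , σ⊆σ₁ , b , p = orderIso-forth iso a
          σ₂ , iso₂ , σ₁⊆σ₂ , ps = orderIso-forth-list iso₁ as
      in σ₂ , iso₂ , σ₁⊆σ₂ ∘ σ⊆σ₁ , λ { (here refl) → b , σ₁⊆σ₂ p ; (there a∈) → ps a∈ }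

    orderIso-back : ∀ {σ} → OrderIso σ → ∀ b → ∃[ σ′ ] OrderIso σ′ × σ ⊆ σ′ × ∃[ a ] (a , b) ∈ σ′
    orderIso-back iso b with orderIso-forth (orderIso-swap iso) b
    ... | σ′ , iso′ , σ⊆σ′ , a , p = map swap σ′ , orderIso-swap iso′ , ∈-swap⁺ ∘ σ⊆σ′ ∘ ∈-swap⁺ , a , ∈-swap⁺ p

    -- Finite unions of points and intervals.

    open Order _<_ using (Interval; point; interval; FiniteUnion)
    open Extrema _<_ using (_<±_; <±-trans; [<]-injective; ⊥±<[_]; [_]<⊤±; [_])

    SameCut : List A → A → A → Set
    SameCut F x y = ∀ {f} → f ∈ F → (f < x → f < y) × (f ≡ x → f ≡ y) × (x < f → y < f)

    finiteUnion-∪ : ∀ {X P Q : Pred A 0ℓ} → FiniteUnion P → FiniteUnion Q →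
      (∀ {x} → X x → P x ⊎ Q x) → (∀ {x} → P x ⊎ Q x → X x) → FiniteUnion X
    finiteUnion-∪ (ps , P⊆ , ⊆P) (qs , Q⊆ , ⊆Q) to from = ps ++ qs ,
      (λ Xx → [ Any.++⁺ˡ ∘ P⊆ , Any.++⁺ʳ ps ∘ Q⊆ ]′ (to Xx)) ,
      λ x∈ → from ([ inj₁ ∘ ⊆P , inj₂ ∘ ⊆Q ]′ (Any.++⁻ ps x∈))

    -- Induction on `F`. With no cut points left, `X` contains all or nothing of the interval. A cut
    -- point outside the interval separates none of its points and is dropped; one inside splits the
    -- interval into two intervals and a point.
    finiteUnion-within : ∀ (X : Pred A 0ℓ) a b F →
      (∀ {x y} → Interval a b x → Interval a b y → SameCut F x y → X x → X y) →
      FiniteUnion (λ x → X x × Interval a b x)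
    finiteUnion-within X a b [] inv with em {∃[ x ] X x × Interval a b x}
    ... | yes (x , Xx , x∈) = interval a b ∷ [] ,
          (λ (_ , y∈) → here y∈) , λ { (here y∈) → inv x∈ y∈ (λ ()) Xx , y∈ }
    ... | no empty = [] , (λ p → contradiction (_ , p) empty) , λ ()
    finiteUnion-within X a b (f ∷ F) inv with em {Interval a b f}
    ... | no f∉ = finiteUnion-within X a b F λ x∈ y∈ same → inv x∈ y∈ λ
      { (here refl) → above x∈ y∈ , (λ { refl → contradiction x∈ f∉ }) , below x∈ y∈
      ; (there p) → same p }
      where
      above : ∀ {x y} → Interval a b x → Interval a b y → f < x → f < y
      above {x} {y} (_ , x<b) (a<y , _) f<x with compare f y
      ... | tri< f<y _ _ = f<y
      ... | tri≈ _ refl _ = contradiction (a<y , <±-trans <-trans [ f<x ] x<b) f∉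
      ... | tri> _ _ y<f = contradiction (<±-trans <-trans a<y [ y<f ] , <±-trans <-trans [ f<x ] x<b) f∉
      below : ∀ {x y} → Interval a b x → Interval a b y → x < f → y < f
      below {x} {y} (a<x , _) (_ , y<b) x<f with compare y f
      ... | tri< y<f _ _ = y<f
      ... | tri≈ _ refl _ = contradiction (<±-trans <-trans a<x [ x<f ] , y<b) f∉
      ... | tri> _ _ f<y = contradiction (<±-trans <-trans a<x [ x<f ] , <±-trans <-trans [ f<y ] y<b) f∉
    ... | yes (a<f , f<b) = finiteUnion-∪
      (finiteUnion-∪ (finiteUnion-within X a [ f ] F inv-left)
                     (finiteUnion-within X [ f ] b F inv-right) id id)
      at-f
      (λ { {x} (Xx , a<x , x<b) → split Xx a<x x<b })
      λ { (inj₁ (inj₁ (Xx , a<x , x<f))) → Xx , a<x , <±-trans <-trans x<f f<b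
        ; (inj₁ (inj₂ (Xx , f<x , x<b))) → Xx , <±-trans <-trans a<f f<x , x<b
        ; (inj₂ (Xx , refl)) → Xx , a<f , f<b }
      where
      inv-left : ∀ {x y} → Interval a [ f ] x → Interval a [ f ] y → SameCut F x y → X x → X y
      inv-left (a<x , x<f) (a<y , y<f) same =
        inv (a<x , <±-trans <-trans x<f f<b) (a<y , <±-trans <-trans y<f f<b) λ
          { (here refl) → (λ f<x → contradiction f<x (asym ([<]-injective x<f)))
                        , (λ { refl → contradiction ([<]-injective x<f) (irrefl refl) }) , (λ _ → [<]-injective y<f)
          ; (there p) → same p }
      inv-right : ∀ {x y} → Interval [ f ] b x → Interval [ f ] b y → SameCut F x y → X x → X y
      inv-right (f<x , x<b) (f<y , y<b) same =
        inv (<±-trans <-trans a<f f<x , x<b) (<±-trans <-trans a<f f<y , y<b) λ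
          { (here refl) → (λ _ → [<]-injective f<y)
                        , (λ { refl → contradiction ([<]-injective f<x) (irrefl refl) }) , (λ x<f → contradiction x<f (asym ([<]-injective f<x)))
          ; (there p) → same p }
      at-f : FiniteUnion (λ x → X x × x ≡ f)
      at-f with em {X f}
      ... | yes Xf = point f ∷ [] , (λ (_ , x≡f) → here x≡f) , λ { (here refl) → Xf , refl }
      ... | no ¬Xf = [] , (λ { (Xf , refl) → contradiction Xf ¬Xf }) , λ ()
      split : ∀ {x} → X x → a <± [ x ] → [ x ] <± b →
              ((X x × Interval a [ f ] x) ⊎ (X x × Interval [ f ] b x)) ⊎ (X x × x ≡ f)
      split {x} Xx a<x x<b with compare x f
      ... | tri< x<f _ _ = inj₁ (inj₁ (Xx , a<x , [ x<f ]))
      ... | tri≈ _ x≡f _ = inj₂ (Xx , x≡f)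
      ... | tri> _ _ f<x = inj₁ (inj₂ (Xx , [ f<x ] , x<b))

    finiteUnion : ∀ (X : Pred A 0ℓ) F → (∀ {x y} → SameCut F x y → X x → X y) → FiniteUnion X
    finiteUnion X F inv with finiteUnion-within X ⊥± ⊤± F (λ _ _ → inv)
    ... | ps , X⊆ , ⊆X = ps , (λ Xx → X⊆ (Xx , ⊥±<[ _ ] , [ _ ]<⊤±)) , proj₁ ∘ ⊆X

-- Back-and-forth systems and finite supports.

Related : ∀ {A : Set} {n} → List (A × A) → Vec A n → Vec A n → Set
Related σ = VecPointwise.Pointwise (λ a b → (a , b) ∈ σ)

module Preservation {L : Language ℓ} (relational : ∀ {k} → ¬ Language.Function L k)
  (M : Structure L)
  (I : List (Structure.Carrier M × Structure.Carrier M) → Set)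
  (forth : ∀ {σ} → I σ → ∀ a → ∃[ σ′ ] I σ′ × σ ⊆ σ′ × ∃[ b ] (a , b) ∈ σ′)
  (back : ∀ {σ} → I σ → ∀ b → ∃[ σ′ ] I σ′ × σ ⊆ σ′ × ∃[ a ] (a , b) ∈ σ′)
  (equality : ∀ {σ} → I σ → ∀ {a b a′ b′} → (a , b) ∈ σ → (a′ , b′) ∈ σ → a ≡ a′ ⇔ b ≡ b′)
  where

  open Structure M

  -- Finite support relative to the system `I`: members of `I` that fix `F` pointwise cannot tell
  -- related tuples apart. The notion is used for two systems, colour-respecting maps on the
  -- expansion and all order isomorphisms on the open core.
  Supports : List Carrier → ∀ {n} → Pred (Vec Carrier n) 0ℓ → Set
  Supports F X = ∀ {σ} → I σ → (∀ {f} → f ∈ F → (f , f) ∈ σ) →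
                 ∀ {v w} → Related σ v w → X v ⇔ X w

  evals-related : ∀ {n k σ} (ts : Vec (Term L n) k) {v w} → Related σ v w →
                  Related σ (evals M ts v) (evals M ts w)
  evals-related []           v∼w = []
  evals-related (var i ∷ ts) v∼w = VecPointwise.lookup v∼w i ∷ evals-related ts v∼w
  evals-related (app f _ ∷ _) v∼w = contradiction f relational

  open Equivalence

  -- Supports of subformulas are united. At a quantifier, `forth` or `back` supplies the partner of
  -- the new point; both only enlarge `σ`, so the support stays fixed.
  formula-supported : (∀ {k} (r : Language.Relation L k) → ∃[ F ] Supports F (⟦_⟧ʳ r)) →
                      ∀ {n} (φ : Formula L n) → ∃[ F ] Supports F (λ v → M ⊨ φ [ v ])
  formula-supported base (s ≈′ t) = [] , λ Iσ _ v∼w → lemma (evals-related (s ∷ t ∷ []) v∼w) Iσ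
    where
    lemma : ∀ {σ a a′ b b′} → Related σ (a ∷ a′ ∷ []) (b ∷ b′ ∷ []) → I σ → a ≡ a′ ⇔ b ≡ b′
    lemma (p ∷ q ∷ []) Iσ = equality Iσ p q
  formula-supported base (rel r ts) =
    let F , supp = base r in F , λ Iσ fix v∼w → supp Iσ fix (evals-related ts v∼w)
  formula-supported base (¬′ φ) =
    let F , supp = formula-supported base φ in
    F , λ Iσ fix v∼w → let e = supp Iσ fix v∼w in mk⇔ (_∘ from e) (_∘ to e)
  formula-supported base (φ ∧′ ψ) =
    let F , supp = formula-supported base φ ; G , supp′ = formula-supported base ψ in
    F ++ G , λ Iσ fix v∼w →
      let e = supp Iσ (fix ∘ ∈-++⁺ˡ) v∼w ; e′ = supp′ Iσ (fix ∘ ∈-++⁺ʳ F) v∼w in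
      mk⇔ (λ (p , q) → to e p , to e′ q) (λ (p , q) → from e p , from e′ q)
  formula-supported base (φ ∨′ ψ) =
    let F , supp = formula-supported base φ ; G , supp′ = formula-supported base ψ in
    F ++ G , λ Iσ fix v∼w →
      let e = supp Iσ (fix ∘ ∈-++⁺ˡ) v∼w ; e′ = supp′ Iσ (fix ∘ ∈-++⁺ʳ F) v∼w in
      mk⇔ [ inj₁ ∘ to e , inj₂ ∘ to e′ ]′ [ inj₁ ∘ from e , inj₂ ∘ from e′ ]′
  formula-supported base (∀′ φ) =
    let F , supp = formula-supported base φ in
    F , λ Iσ fix v∼w → mk⇔
      (λ p y → let σ′ , Iσ′ , σ⊆σ′ , x , x∼y = back Iσ y in
        to (supp Iσ′ (σ⊆σ′ ∘ fix) (x∼y ∷ VecPointwise.map σ⊆σ′ v∼w)) (p x))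
      (λ q x → let σ′ , Iσ′ , σ⊆σ′ , y , x∼y = forth Iσ x in
        from (supp Iσ′ (σ⊆σ′ ∘ fix) (x∼y ∷ VecPointwise.map σ⊆σ′ v∼w)) (q y))
  formula-supported base (∃′ φ) =
    let F , supp = formula-supported base φ in
    F , λ Iσ fix v∼w → mk⇔
      (λ (x , p) → let σ′ , Iσ′ , σ⊆σ′ , y , x∼y = forth Iσ x in
        y , to (supp Iσ′ (σ⊆σ′ ∘ fix) (x∼y ∷ VecPointwise.map σ⊆σ′ v∼w)) p)
      (λ (y , q) → let σ′ , Iσ′ , σ⊆σ′ , x , x∼y = back Iσ y in
        x , from (supp Iσ′ (σ⊆σ′ ∘ fix) (x∼y ∷ VecPointwise.map σ⊆σ′ v∼w)) q)

  related-refl : ∀ {σ m} (p : Vec Carrier m) → (∀ {f} → f ∈ toList p → (f , f) ∈ σ) → Related σ p p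
  related-refl []      fix = []
  related-refl (x ∷ p) fix = fix (here refl) ∷ related-refl p (fix ∘ there)

  definable-supported : (∀ {k} (r : Language.Relation L k) → ∃[ F ] Supports F (⟦_⟧ʳ r)) →
                        ∀ {n} (X : Pred (Vec Carrier n) 0ℓ) → Definable M X → ∃[ F ] Supports F X
  definable-supported base X (m , φ , p , X⊆ , ⊆X) =
    let F , supp = formula-supported base φ in
    -- The parameters join the support, so that they are related to themselves.
    F ++ toList p , λ Iσ fix v∼w →
      let e = supp Iσ (fix ∘ ∈-++⁺ˡ) (VecPointwise.++⁺ v∼w (related-refl p (fix ∘ ∈-++⁺ʳ F)))
      in mk⇔ (⊆X ∘ to e ∘ X⊆) (⊆X ∘ from e ∘ X⊆)

-- Coloured dense orders and their back-and-forth system.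

data Symbol : ℕ → Set where
  less member : Symbol 2

colouredLanguage : OrderedLanguage
colouredLanguage = record
  { language = record { Function = λ _ → ⊥ ; Relation = Symbol } ; less = less }

module Coloured {A : Set} {_<_ : Rel A 0ℓ} (isDLO : IsDenseLinearOrder _≡_ _<_)
  (no-least : ∀ x → ∃[ y ] y < x) (no-greatest : ∀ x → ∃[ y ] x < y) (origin : A)
  (κ : A → List A) (κ-wellFounded : WellFounded (λ x p → x ∈ κ p))
  (κ-dense : ∀ {a b} → a < b → ∀ xs → ∃[ c ] a < c × c < b × κ c ≡ xs)
  (em : ExcludedMiddle 0ℓ) where

  open DenseOrder isDLO no-least no-greatest

  colouredStructure : Structure (OrderedLanguage.language colouredLanguage)
  colouredStructure = record
    { Carrier = A ; nonempty = origin ; ⟦_⟧ᶠ = λ () ; ⟦_⟧ʳ = interpretation }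
    where
    interpretation : ∀ {k} → Symbol k → Pred (Vec A k) 0ℓ
    interpretation less   (x ∷ y ∷ []) = x < y
    interpretation member (p ∷ x ∷ []) = x ∈ κ p

  expansion : DLOExpansion colouredLanguage
  expansion = record
    { structure = colouredStructure ; isDenseLinearOrder = isDLO
    ; no-least = no-least ; no-greatest = no-greatest }

  open Structure colouredStructure using (⟦_⟧ʳ)

  -- Matching the lists entry by entry forces the domain and the range of `σ` to be closed under
  -- `κ`.
  RespectsColours : Graph → Set
  RespectsColours σ = ∀ {a b} → (a , b) ∈ σ → ListPointwise.Pointwise (λ x y → (x , y) ∈ σ) (κ a) (κ b)

  Good : Graph → Set
  Good σ = OrderIso σ × RespectsColours σ

  good-swap : ∀ {σ} → Good σ → Good (map swap σ)
  good-swap (iso , col) = orderIso-swap iso ,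
    λ p → ListPointwise.symmetric ∈-swap⁺ (col (∈-swap⁻ p))

  good-∷ : ∀ {σ a b} → Good σ → Fits σ a b → (∀ b′ → (a , b′) ∉ σ) →
           ListPointwise.Pointwise (λ x y → (x , y) ∈ σ) (κ a) (κ b) → Good ((a , b) ∷ σ)
  good-∷ (iso , col) fits new κa∼κb = orderIso-∷ iso fits new ,
    λ { (here refl) → ListPointwise.map there κa∼κb ; (there p) → ListPointwise.map there (col p) }

  -- If `c` itself belongs to `B`, then `b` may lie on either side of it: `b` is a perturbation of
  -- `c` that crosses no other point of `B`.
  Near : List A → A → A → Set
  Near B c b = ∀ {e} → e ∈ B → (e < c → e < b) × (c < e → b < e)

  near-with-colour : ∀ B c xs → ∃[ b ] Near B c b × κ b ≡ xs
  near-with-colour B c xs =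
    let u , c<u , u<B = gap-above c B
        l , l<c , B<l = gap-below c B
        b , l<b , b<u , κb≡xs = κ-dense (<-trans l<c c<u) xs
    in b , (λ e∈B → (λ e<c → <-trans (B<l e∈B e<c) l<b) , (λ c<e → <-trans b<u (u<B e∈B c<e))) , κb≡xs

  -- By density of colours, a fitting value `c` can be perturbed to a point of the prescribed colour
  -- `xs`. The images of `σ` are added to the points not to be crossed, so the perturbed value still
  -- fits.
  near-∷ : ∀ {σ a c xs} → Good σ → Fits σ a c → (∀ b′ → (a , b′) ∉ σ) →
           ListPointwise.Pointwise (λ x y → (x , y) ∈ σ) (κ a) xs →
           ∀ B → ∃[ b ] Near B c b × Good ((a , b) ∷ σ)
  near-∷ {σ} {a} {c} {xs} good fits new κa∼xs B
    with near-with-colour (B ++ map proj₂ σ) c xs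
  ... | b , near , refl = b , near ∘ ∈-++⁺ˡ , good-∷ good fits-b new κa∼xs
    where
    fits-b : Fits σ a b
    fits-b p = let e = ∈-++⁺ʳ B (∈-map⁺ proj₂ p) in
      proj₁ (near e) ∘ proj₁ (fits p) , proj₂ (near e) ∘ proj₂ (fits p)

  -- Extends a graph to further points of a `κ`-closed set `Z` while keeping an invariant. The three
  -- uses are the forth property, finite `κ`-closures, and the perturbation of an order isomorphism.
  module Saturation (Inv : Graph → Set) (Z : A → Set)
    (Z-closed : ∀ {a x} → Z a → x ∈ κ a → Z x)
    (step : ∀ {σ a xs} → Inv σ → Z a → (∀ b → (a , b) ∉ σ) →
            ListPointwise.Pointwise (λ x y → (x , y) ∈ σ) (κ a) xs → ∃[ b ] Inv ((a , b) ∷ σ)) where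

    Extends : Graph → A → Set
    Extends σ a = ∃[ σ′ ] Inv σ′ × σ ⊆ σ′ × ∃[ b ] (a , b) ∈ σ′

    extend-list : ∀ {σ} as → (∀ {x} → x ∈ as → ∀ {σ} → Inv σ → Extends σ x) → Inv σ →
                  ∃[ σ′ ] Inv σ′ × σ ⊆ σ′ × ∃[ bs ] ListPointwise.Pointwise (λ x y → (x , y) ∈ σ′) as bs
    extend-list []       ext inv = _ , inv , id , [] , ListPointwise.[]
    extend-list (a ∷ as) ext inv =
      let σ₁ , inv₁ , σ⊆σ₁ , b , p = ext (here refl) inv
          σ₂ , inv₂ , σ₁⊆σ₂ , bs , ps = extend-list as (ext ∘ there) inv₁
      in σ₂ , inv₂ , σ₁⊆σ₂ ∘ σ⊆σ₁ , b ∷ bs , σ₁⊆σ₂ p ListPointwise.∷ ps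

    -- Recursion along `κ`: once all points of `κ a` have images, the list of these images is the
    -- colour that the image of `a` must carry, and `step` provides such an image.
    saturate-acc : ∀ {a} → Acc (λ x p → x ∈ κ p) a → Z a → ∀ {σ} → Inv σ → Extends σ a
    saturate-acc {a = a} (acc rs) Za inv
      with extend-list (κ a) (λ x∈ → saturate-acc (rs x∈) (Z-closed Za x∈)) inv
    ... | σ′ , inv′ , σ⊆σ′ , xs , κa∼xs with em {∃[ b ] (a , b) ∈ σ′}
    ...   | yes p = σ′ , inv′ , σ⊆σ′ , p
    ...   | no new = let b , inv″ = step inv′ Za (λ b p → new (b , p)) κa∼xs in
      (a , b) ∷ σ′ , inv″ , there ∘ σ⊆σ′ , b , here refl

    saturate : ∀ {σ a} → Inv σ → Z a → Extends σ a
    saturate inv Za = saturate-acc (κ-wellFounded _) Za inv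

    saturates : ∀ {σ n} (v : Vec A n) → Inv σ → (∀ i → Z (lookup v i)) →
                ∃[ σ′ ] Inv σ′ × σ ⊆ σ′ × ∃[ w ] Related σ′ v w
    saturates []      inv _  = _ , inv , id , [] , []
    saturates (a ∷ v) inv Zs =
      let σ₁ , inv₁ , σ⊆σ₁ , b , p = saturate inv (Zs zero)
          σ₂ , inv₂ , σ₁⊆σ₂ , w , ps = saturates v inv₁ (Zs ∘ suc)
      in σ₂ , inv₂ , σ₁⊆σ₂ ∘ σ⊆σ₁ , b ∷ w , σ₁⊆σ₂ p ∷ ps

  good-forth : ∀ {σ} → Good σ → ∀ a → ∃[ σ′ ] Good σ′ × σ ⊆ σ′ × ∃[ b ] (a , b) ∈ σ′
  good-forth good a = Saturation.saturate Good (λ _ → ⊤) (λ _ _ → tt) step good tt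
    where
    step : ∀ {σ a xs} → Good σ → ⊤ → (∀ b → (a , b) ∉ σ) →
           ListPointwise.Pointwise (λ x y → (x , y) ∈ σ) (κ a) xs → ∃[ b ] Good ((a , b) ∷ σ)
    step {a = a} good _ new κa∼xs =
      let c , fits = fits-exists (proj₁ good) a ; b , _ , good′ = near-∷ good fits new κa∼xs [] in b , good′

  good-back : ∀ {σ} → Good σ → ∀ b → ∃[ σ′ ] Good σ′ × σ ⊆ σ′ × ∃[ a ] (a , b) ∈ σ′
  good-back good b with good-forth (good-swap good) b
  ... | σ′ , good′ , σ⊆σ′ , a , p = map swap σ′ , good-swap good′ , ∈-swap⁺ ∘ σ⊆σ′ ∘ ∈-swap⁺ , a , ∈-swap⁺ p

  pointwise-∈ : ∀ {σ : Graph} {xs ys x} → ListPointwise.Pointwise (λ x y → (x , y) ∈ σ) xs ys →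
                x ∈ xs → ∃[ y ] (x , y) ∈ σ × y ∈ ys
  pointwise-∈ (p ListPointwise.∷ _)  (here refl) = _ , p , here refl
  pointwise-∈ (_ ListPointwise.∷ ps) (there x∈) = let y , q , y∈ = pointwise-∈ ps x∈ in y , q , there y∈

  good-member : ∀ {σ : Graph} {p q x y} → Good σ → (p , q) ∈ σ → (x , y) ∈ σ → x ∈ κ p → y ∈ κ q
  good-member (iso , col) pq xy x∈ = let y′ , xy′ , y′∈ = pointwise-∈ (col pq) x∈ in
    subst (_∈ κ _) (orderIso-functional iso xy′ xy refl) y′∈

  module G = Preservation (λ ()) colouredStructure Good good-forth good-back (orderIso-≡ ∘ proj₁)

  symbol-supported : ∀ {k} (r : Symbol k) → ∃[ F ] G.Supports F (⟦ r ⟧ʳ)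
  symbol-supported less   = [] , λ { (iso , _) _ (p ∷ q ∷ []) → mk⇔ (proj₁ (iso p q)) (proj₂ (iso p q)) }
  symbol-supported member = [] , λ { good _ (p ∷ q ∷ []) →
    mk⇔ (good-member good p q) (good-member (good-swap good) (∈-swap⁺ p) (∈-swap⁺ q)) }

  -- A finite `κ`-closed set of points, represented by the identity map on it.
  IdGood : Graph → Set
  IdGood σ = Good σ × (∀ {a b} → (a , b) ∈ σ → a ≡ b)

  closure : ∀ {σ} → IdGood σ → ∀ as → ∃[ σ′ ] IdGood σ′ × σ ⊆ σ′ × Fixes as σ′
  closure idGood as =
    let σ′ , (good′ , id′) , σ⊆σ′ , _ , as∼bs = extend-list as (λ _ inv → saturate inv tt) idGood in
    σ′ , (good′ , id′) , σ⊆σ′ , λ f∈ → fixed id′ (pointwise-∈ as∼bs f∈)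
    where
    fixed : ∀ {σ : Graph} {f} {P : A → Set} → (∀ {a b} → (a , b) ∈ σ → a ≡ b) →
            ∃[ y ] (f , y) ∈ σ × P y → (f , f) ∈ σ
    fixed id′ (y , p , _) with refl ← id′ p = p
    step : ∀ {σ a xs} → IdGood σ → ⊤ → (∀ b → (a , b) ∉ σ) →
           ListPointwise.Pointwise (λ x y → (x , y) ∈ σ) (κ a) xs → ∃[ b ] IdGood ((a , b) ∷ σ)
    -- Under an identity graph the images of `κ a` are `κ a` again, so `a` can be its own image.
    step {σ} {a} (good , id′) _ new κa∼xs = a ,
      good-∷ good fits new (subst (ListPointwise.Pointwise _ (κ a)) (diagonal κa∼xs) κa∼xs) ,
      λ { (here refl) → refl ; (there p) → id′ p }
      where
      fits : Fits σ a a
      fits p with refl ← id′ p = id , id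
      diagonal : ∀ {xs ys} → ListPointwise.Pointwise (λ x y → (x , y) ∈ σ) xs ys → ys ≡ xs
      diagonal ListPointwise.[] = refl
      diagonal (p ListPointwise.∷ ps) = cong₂ _∷_ (sym (id′ p)) (diagonal ps)
    open Saturation IdGood (λ _ → ⊤) (λ _ _ → tt) step

  -- Open definable sets and the open core.

  open Order _<_ using (Interval; Box; Open)
  open Extrema _<_ using (_<±_; <±-asym; [<]-injective; ⊥±<[_]; [_]<⊤±; [_])

  endpoint : A ± → List A
  endpoint [ a ] = a ∷ []
  endpoint _     = []

  endpoints : ∀ {n} → Vec (A ±) n → List A
  endpoints []       = []
  endpoints (a ∷ as) = endpoint a ++ endpoints as

  endpoint⊆endpoints : ∀ {n} (as : Vec (A ±) n) i → endpoint (lookup as i) ⊆ endpoints as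
  endpoint⊆endpoints (a ∷ as) zero    = ∈-++⁺ˡ
  endpoint⊆endpoints (a ∷ as) (suc i) = ∈-++⁺ʳ (endpoint a) ∘ endpoint⊆endpoints as i

  near-interval : ∀ {B c x} s t → Near B c x → endpoint s ⊆ B → endpoint t ⊆ B →
                  Interval s t c → Interval s t x
  near-interval {B} {c} {x} s t near s⊆ t⊆ (s<c , c<t) = lower s s⊆ s<c , upper t t⊆ c<t
    where
    lower : ∀ s → endpoint s ⊆ B → s <± [ c ] → s <± [ x ]
    lower ⊥±    _  _   = ⊥±<[ x ]
    lower [ a ] s⊆ a<c = [ proj₁ (near (s⊆ (here refl))) ([<]-injective a<c) ]
    upper : ∀ t → endpoint t ⊆ B → [ c ] <± t → [ x ] <± t
    upper ⊥±    _  c<⊥ = contradiction ⊥±<[ c ] (<±-asym asym c<⊥)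
    upper ⊤±    _  _   = [ x ]<⊤±
    upper [ a ] t⊆ c<a = [ proj₂ (near (t⊆ (here refl))) ([<]-injective c<a) ]

  module H = Preservation (λ ()) (openCore expansion) OrderIso
    (orderIso-forth em) (orderIso-back em) orderIso-≡

  -- The images under τ are perturbed, staying inside a box contained in U, so that
  -- the partial isomorphism also respects colours.
  module _ {n} {U : Pred (Vec A n) 0ℓ} (open-U : Open U) {F₀} (U-supported : G.Supports F₀ U)
           {σ₀} (idGood₀ : IdGood σ₀) (F₀-fixed : Fixes F₀ σ₀) where

    transfer : ∀ {τ v w} → OrderIso τ → Fixes (map proj₁ σ₀) τ → Related τ v w → U w → U v
    transfer {τ} {v} {w} iso fix v∼w Uw
      with open-U w Uw | closure idGood₀ (toList v)
    ... | as , bs , w∈ , box⊆U | σ₁ , ((iso₁ , col₁) , id₁) , σ₀⊆σ₁ , v-fixed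
      -- Colours force the perturbed map to be defined on `κ`-closed sets, so `τ` is first extended
      -- to a closure of `v` and `σ₀`.
      with orderIso-forth-list em iso (map proj₁ σ₁)
    ... | τ′ , iso′ , τ⊆τ′ , total = conclude (saturates v start Z-v)
      where
      -- Not crossing the endpoints keeps the perturbed tuple in the box; not crossing the images of
      -- `τ′` keeps the perturbed points in the right order.
      B = (endpoints as ++ endpoints bs) ++ map proj₂ τ′
      Inv : Graph → Set
      Inv σ = Good σ × (∀ {a b} → (a , b) ∈ σ → ∃[ c ] (a , c) ∈ τ′ × Near B c b)
      Z : A → Set
      Z a = (a , a) ∈ σ₁
      Z-closed : ∀ {a x} → Z a → x ∈ κ a → Z x
      Z-closed Za x∈ with pointwise-∈ (col₁ Za) x∈
      ... | y , p , _ with refl ← id₁ p = p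
      step : ∀ {σ a xs} → Inv σ → Z a → (∀ b → (a , b) ∉ σ) →
             ListPointwise.Pointwise (λ x y → (x , y) ∈ σ) (κ a) xs → ∃[ b ] Inv ((a , b) ∷ σ)
      step {σ} {a} (good , near) Za new κa∼xs =
        let b , near-b , good′ = near-∷ good fits new κa∼xs B in
        b , good′ , λ { (here refl) → c , ac , near-b ; (there p) → near p }
        where
        c = proj₁ (total (∈-map⁺ proj₁ Za))
        ac = proj₂ (total (∈-map⁺ proj₁ Za))
        c∈B : c ∈ B
        c∈B = ∈-++⁺ʳ (endpoints as ++ endpoints bs) (∈-map⁺ proj₂ ac)
        fits : Fits σ a c
        -- The earlier image `b′` perturbs `c′` without crossing `c`, so it compares with `c` as
        -- `c′` does.
        fits p = let c′ , ac′ , near′ = near p in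
          proj₂ (near′ c∈B) ∘ proj₁ (iso′ ac′ ac) , proj₁ (near′ c∈B) ∘ proj₁ (iso′ ac ac′)
      open Saturation Inv Z Z-closed step
      start : Inv σ₀
      start = proj₁ idGood₀ , near
        where
        near : ∀ {a b} → (a , b) ∈ σ₀ → ∃[ c ] (a , c) ∈ τ′ × Near B c b
        near {a} p with refl ← proj₂ idGood₀ p = a , τ⊆τ′ (fix (∈-map⁺ proj₁ p)) , λ _ → id , id
      Z-v : ∀ i → Z (lookup v i)
      Z-v i = v-fixed (∈-toList⁺ (∈-lookup i v))
      conclude : ∃[ σ ] Inv σ × σ₀ ⊆ σ × ∃[ v′ ] Related σ v v′ → U v
      conclude (σ , (good , near) , σ₀⊆σ , v′ , v∼v′) =
        -- The perturbed tuple `v′` is in `U` by openness, and the colour-respecting `σ` carries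
        -- this back to `v`.
        Equivalence.from (U-supported good (σ₀⊆σ ∘ F₀-fixed) v∼v′) (box⊆U v′∈)
        where
        v′∈ : Box as bs v′
        v′∈ i with near (VecPointwise.lookup v∼v′ i)
        ... | c , p , near-c
          with refl ← orderIso-functional iso′ p (τ⊆τ′ (VecPointwise.lookup v∼w i)) refl =
          near-interval (lookup as i) (lookup bs i) near-c
            (∈-++⁺ˡ ∘ ∈-++⁺ˡ ∘ endpoint⊆endpoints as i)
            (∈-++⁺ˡ ∘ ∈-++⁺ʳ (endpoints as) ∘ endpoint⊆endpoints bs i) (w∈ i)

  -- The new support is the `κ`-closure of the old one: its identity map respects colours, so the
  -- perturbed map can be started there. Inverting `τ` gives the other implication.
  open-supported : ∀ {n} (U : Pred (Vec A n) 0ℓ) → Definable colouredStructure U → Open U →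
                   ∃[ F ] H.Supports F U
  open-supported U def open-U = from-support (G.definable-supported symbol-supported U def)
    where
    from-closure : ∀ {F₀} → G.Supports F₀ U → ∃[ σ ] IdGood σ × [] ⊆ σ × Fixes F₀ σ → ∃[ F ] H.Supports F U
    from-closure U-supported (σ₀ , idGood₀ , _ , F₀-fixed) = map proj₁ σ₀ , λ iso fix v∼w →
      mk⇔ (transfer′ (orderIso-swap iso) (∈-swap⁺ ∘ fix) (VecPointwise.sym ∈-swap⁺ v∼w)) (transfer′ iso fix v∼w)
      where
      transfer′ : ∀ {τ v w} → OrderIso τ → Fixes (map proj₁ σ₀) τ → Related τ v w → U w → U v
      transfer′ = transfer open-U U-supported idGood₀ F₀-fixed
    from-support : ∃[ F ] G.Supports F U → ∃[ F ] H.Supports F U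
    from-support (F₀ , U-supported) = from-closure U-supported (closure (((λ ()) , λ ()) , λ ()) F₀)

  -- Two points outside `F` in the same cut of `F` are exchanged by an order isomorphism, namely the
  -- identity on `F` extended by one pair.
  supported-finiteUnion : ∀ (X : Pred A 0ℓ) {F} → H.Supports F (X ∘ head) → Order.FiniteUnion _<_ X
  supported-finiteUnion X {F} supp = finiteUnion em X F inv
    where
    diagonal : OrderIso (map (λ f → f , f) F)
    diagonal p q with ∈-map⁻ (λ f → f , f) p | ∈-map⁻ (λ f → f , f) q
    ... | _ , _ , refl | _ , _ , refl = id , id
    fits : ∀ {x y} → SameCut em F x y → Fits (map (λ f → f , f) F) x y
    fits same p with ∈-map⁻ (λ f → f , f) p
    ... | _ , f∈F , refl = proj₁ (same f∈F) , proj₂ (proj₂ (same f∈F))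
    new : ∀ {x} → x ∉ F → ∀ b → (x , b) ∉ map (λ f → f , f) F
    new x∉F b p with ∈-map⁻ (λ f → f , f) p
    ... | _ , f∈F , refl = x∉F f∈F
    inv : ∀ {x y} → SameCut em F x y → X x → X y
    inv {x} {y} same Xx with em {x ∈ F}
    ... | yes x∈F with refl ← proj₁ (proj₂ (same x∈F)) refl = Xx
    ... | no x∉F = Equivalence.to
        (supp (orderIso-∷ diagonal (fits same) (new x∉F)) (there ∘ ∈-map⁺ (λ f → f , f)) (here refl ∷ [])) Xx

  expansion-hasOMinimalOpenCore : HasOMinimalOpenCore expansion
  expansion-hasOMinimalOpenCore X def = supported-finiteUnion X (proj₂ (H.definable-supported
    (λ (U , def-U , open-U) → open-supported U def-U open-U) (X ∘ head) def))

-- Countability of lists, formulas and codes.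

-- Types are shown countable by injecting them into this one.
data Tree : Set where
  leaf : Tree
  node : ℕ → Tree → Tree → Tree

-- The number `2^m (2n + 1)`.
pair : ℕ → ℕ → ℕ
pair zero    n = suc (2 * n)
pair (suc m) n = 2 * pair m n

pair-injective : ∀ m n {m′ n′} → pair m n ≡ pair m′ n′ → m ≡ m′ × n ≡ n′
pair-injective zero    n {zero}       eq = refl , ℕ.*-cancelˡ-≡ _ _ 2 (ℕ.suc-injective eq)
pair-injective zero    n {suc m′} {n′} eq = contradiction (sym eq) (ℕ.even≢odd (pair m′ n′) n)
pair-injective (suc m) n {zero} {n′}  eq = contradiction eq (ℕ.even≢odd (pair m n) n′)
pair-injective (suc m) n {suc m′}     eq =
  let m≡m′ , n≡n′ = pair-injective m n (ℕ.*-cancelˡ-≡ _ _ 2 eq) in cong suc m≡m′ , n≡n′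

-- Makes codes grow strictly from subtrees to trees, on which the well-foundedness of the colouring
-- will rest.
pair-bound : ∀ m n → m + n ℕ.< pair m n
pair-bound zero    n = s≤s (ℕ.m≤m+n n _)
pair-bound (suc m) n = ℕ.+-mono-≤ (ℕ.≤-trans (s≤s z≤n) ih) (ℕ.≤-trans ih (ℕ.m≤m+n _ 0))
  where ih = pair-bound m n

code : Tree → ℕ
code leaf         = zero
code (node k s t) = suc (pair k (pair (code s) (code t)))

code-injective : ∀ s t → code s ≡ code t → s ≡ t
code-injective leaf leaf eq = refl
code-injective (node k s t) (node k′ s′ t′) eq
  with refl , eq′ ← pair-injective k _ {k′} (ℕ.suc-injective eq)
  with eqₛ , eqₜ ← pair-injective (code s) (code t) eq′ =
  cong₂ (node k) (code-injective s s′ eqₛ) (code-injective t t′ eqₜ)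

code-<ˡ : ∀ k s t → code s ℕ.< code (node k s t)
code-<ˡ k s t = s≤s (ℕ.≤-trans (ℕ.≤-trans (ℕ.m≤m+n _ _) (ℕ.<⇒≤ (pair-bound (code s) (code t))))
                             (ℕ.≤-trans (ℕ.m≤n+m _ k) (ℕ.<⇒≤ (pair-bound k _))))

code-<ʳ : ∀ k s t → code t ℕ.< code (node k s t)
code-<ʳ k s t = s≤s (ℕ.≤-trans (ℕ.≤-trans (ℕ.m≤n+m _ (code s)) (ℕ.<⇒≤ (pair-bound (code s) (code t))))
                             (ℕ.≤-trans (ℕ.m≤n+m _ k) (ℕ.<⇒≤ (pair-bound k _))))

node-injective : ∀ {k s t k′ s′ t′} → node k s t ≡ node k′ s′ t′ → k ≡ k′ × s ≡ s′ × t ≡ t′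
node-injective refl = refl , refl , refl

Injective : ∀ {A B : Set} → (A → B) → Set
Injective f = ∀ x y → f x ≡ f y → x ≡ y

code-∘-injective : ∀ {A : Set} {f : A → Tree} → Injective f → Injective (code ∘ f)
code-∘-injective inj x y eq = inj x y (code-injective _ _ eq)

listTree : ∀ {A : Set} → (A → Tree) → List A → Tree
listTree f []       = leaf
listTree f (x ∷ xs) = node 0 (f x) (listTree f xs)

listTree-injective : ∀ {A : Set} {f : A → Tree} → Injective f → Injective (listTree f)
listTree-injective inj []       []       eq = refl
listTree-injective inj (x ∷ xs) (y ∷ ys) eq = let _ , p , q = node-injective eq in
  cong₂ _∷_ (inj x y p) (listTree-injective inj xs ys q)

length≤code : ∀ {A : Set} (f : A → Tree) xs → length xs ≤ code (listTree f xs)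
length≤code f []       = z≤n
length≤code f (x ∷ xs) = ℕ.<-≤-trans (s≤s (length≤code f xs)) (code-<ʳ 0 (f x) (listTree f xs))

member-code : ∀ {A : Set} (f : A → Tree) {x xs} → x ∈ xs → code (f x) ℕ.< code (listTree f xs)
member-code f {xs = x ∷ xs} (here refl) = code-<ˡ 0 (f x) (listTree f xs)
member-code f {xs = x ∷ xs} (there x∈) = ℕ.<-trans (member-code f x∈) (code-<ʳ 0 (f x) (listTree f xs))

module Encoding {L : Language 0ℓ} (relational : ∀ {k} → ¬ Language.Function L k)
  (symbolTree : ∀ {k} → Language.Relation L k → Tree)
  (symbolTree-injective : ∀ {k} → Injective (symbolTree {k})) where

  varTree : ∀ {n} → Term L n → Tree
  varTree (var i)   = node (toℕ i) leaf leaf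
  varTree (app f _) = contradiction f relational

  varTree-injective : ∀ {n} → Injective (varTree {n})
  varTree-injective (var i) (var j) eq = cong var (toℕ-injective (proj₁ (node-injective eq)))
  varTree-injective (app f _) _ _ = contradiction f relational
  varTree-injective _ (app f _) _ = contradiction f relational

  vecTree : ∀ {A : Set} {n} → (A → Tree) → Vec A n → Tree
  vecTree f []       = leaf
  vecTree f (x ∷ xs) = node 0 (f x) (vecTree f xs)

  vecTree-injective : ∀ {A : Set} {n} {f : A → Tree} → Injective f → Injective (vecTree {n = n} f)
  vecTree-injective inj []       []       eq = refl
  vecTree-injective inj (x ∷ xs) (y ∷ ys) eq = let _ , p , q = node-injective eq in
    cong₂ _∷_ (inj x y p) (vecTree-injective inj xs ys q)

  formulaTree : ∀ {n} → Formula L n → Tree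
  formulaTree (s ≈′ t)       = node 0 (varTree s) (varTree t)
  -- The arity is recorded because `rel` hides it, and symbols can be compared only once their
  -- arities agree.
  formulaTree (rel {k = k} r ts) = node 1 (node k leaf (symbolTree r)) (vecTree varTree ts)
  formulaTree (¬′ φ)         = node 2 leaf (formulaTree φ)
  formulaTree (φ ∧′ ψ)       = node 3 (formulaTree φ) (formulaTree ψ)
  formulaTree (φ ∨′ ψ)       = node 4 (formulaTree φ) (formulaTree ψ)
  formulaTree (∀′ φ)         = node 5 leaf (formulaTree φ)
  formulaTree (∃′ φ)         = node 6 leaf (formulaTree φ)

  formulaTree-injective : ∀ {n} → Injective (formulaTree {n})
  formulaTree-injective (s ≈′ t) (s′ ≈′ t′) eq = let _ , p , q = node-injective eq in
    cong₂ _≈′_ (varTree-injective s s′ p) (varTree-injective t t′ q)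
  formulaTree-injective (rel r ts) (rel r′ ts′) eq =
    let _ , p , q = node-injective eq ; k≡k′ , _ , p′ = node-injective p in same-arity k≡k′ r r′ ts ts′ p′ q
    where
    same-arity : ∀ {n k k′} → k ≡ k′ → (r : Language.Relation L k) (r′ : Language.Relation L k′)
                 (ts : Vec (Term L n) k) (ts′ : Vec (Term L n) k′) → symbolTree r ≡ symbolTree r′ →
                 vecTree varTree ts ≡ vecTree varTree ts′ → rel r ts ≡ rel r′ ts′
    same-arity refl r r′ ts ts′ p q =
      cong₂ rel (symbolTree-injective r r′ p) (vecTree-injective varTree-injective ts ts′ q)
  formulaTree-injective (¬′ φ) (¬′ φ′) eq = let _ , _ , q = node-injective eq in
    cong ¬′_ (formulaTree-injective φ φ′ q)
  formulaTree-injective (φ ∧′ ψ) (φ′ ∧′ ψ′) eq = let _ , p , q = node-injective eq in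
    cong₂ _∧′_ (formulaTree-injective φ φ′ p) (formulaTree-injective ψ ψ′ q)
  formulaTree-injective (φ ∨′ ψ) (φ′ ∨′ ψ′) eq = let _ , p , q = node-injective eq in
    cong₂ _∨′_ (formulaTree-injective φ φ′ p) (formulaTree-injective ψ ψ′ q)
  formulaTree-injective (∀′ φ) (∀′ φ′) eq = let _ , _ , q = node-injective eq in
    cong ∀′_ (formulaTree-injective φ φ′ q)
  formulaTree-injective (∃′ φ) (∃′ φ′) eq = let _ , _ , q = node-injective eq in
    cong ∃′_ (formulaTree-injective φ φ′ q)

  -- A code denotes a sequence of points: diagonal a given one, skolem φ cs
  -- a termwise choice of witnesses for ∃′ φ at the sequences cs.
  data Code : Set where
    diagonal : Code
    skolem   : ∀ {n} → Formula L (suc n) → Vec Code n → Code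

  mutual
    codeTree : Code → Tree
    codeTree diagonal          = leaf
    codeTree (skolem {n} φ cs) = node n (formulaTree φ) (codesTree cs)

    codesTree : ∀ {n} → Vec Code n → Tree
    codesTree []       = leaf
    codesTree (c ∷ cs) = node 0 (codeTree c) (codesTree cs)

  mutual
    codeTree-injective : Injective codeTree
    codeTree-injective diagonal diagonal eq = refl
    codeTree-injective (skolem φ cs) (skolem ψ ds) eq with node-injective eq
    ... | refl , p , q = cong₂ skolem (formulaTree-injective φ ψ p) (codesTree-injective cs ds q)

    codesTree-injective : ∀ {n} → Injective (codesTree {n})
    codesTree-injective []       []       eq = refl
    codesTree-injective (c ∷ cs) (d ∷ ds) eq = let _ , p , q = node-injective eq in
      cong₂ _∷_ (codeTree-injective c d p) (codesTree-injective cs ds q)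

  -- Indexes the countable family that the ultrafilter has to decide: for each instance, the set of
  -- positions where the formula holds of the coded sequences.
  Instance : Set
  Instance = ∃[ n ] Formula L n × Vec Code n

  instanceTree : Instance → Tree
  instanceTree (n , φ , cs) = node n (formulaTree φ) (codesTree cs)

  instanceTree-injective : Injective instanceTree
  instanceTree-injective (n , φ , cs) (m , ψ , ds) eq with node-injective eq
  ... | refl , p , q = cong₂ (λ χ es → n , χ , es) (formulaTree-injective φ ψ p) (codesTree-injective cs ds q)

-- The ultrafilter and the Skolem ultrapower.

-- An ultrafilter relative to a countable family of sets, presented by a decreasing
-- sequence of infinite sets each of which decides one more member of the family.
module Ultrafilter {J : Set} (index : J → ℕ) (index-injective : Injective index)
  (P : J → Pred ℕ 0ℓ) (em : ExcludedMiddle 0ℓ) where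

  Infinite : Pred ℕ 0ℓ → Set
  Infinite X = ∀ N → ∃[ i ] N ≤ i × X i

  refine : (X Q : Pred ℕ 0ℓ) → Dec (Infinite (λ i → X i × Q i)) → Pred ℕ 0ℓ
  refine X Q (yes _) i = X i × Q i
  refine X Q (no  _) i = X i × ¬ Q i

  stage-step : ∀ k → Dec (∃[ j ] index j ≡ k) → Pred ℕ 0ℓ → Pred ℕ 0ℓ
  stage-step k (yes (j , _)) X = refine X (P j) em
  stage-step k (no  _)       X = X

  stage : ℕ → Pred ℕ 0ℓ
  stage zero    _ = ⊤
  stage (suc k)   = stage-step k em (stage k)

  -- If `X` without `Q` were bounded, then all large elements of `X` would lie in `Q`, and the first
  -- alternative would have been taken.
  refine-infinite : ∀ X Q d → Infinite X → Infinite (refine X Q d)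
  refine-infinite X Q (yes inf) _   = inf
  refine-infinite X Q (no ¬inf) inf N with em {∃[ i ] N ≤ i × X i × ¬ Q i}
  ... | yes p = p
  ... | no ¬p = contradiction infinite ¬inf
    where
    infinite : Infinite (λ i → X i × Q i)
    infinite N′ with inf (N ⊔ N′)
    ... | i , N⊔N′≤i , Xi with em {Q i}
    ...   | yes Qi = i , ℕ.≤-trans (ℕ.m≤n⊔m N N′) N⊔N′≤i , Xi , Qi
    ...   | no ¬Qi = contradiction (i , ℕ.≤-trans (ℕ.m≤m⊔n N N′) N⊔N′≤i , Xi , ¬Qi) ¬p

  stage-step-infinite : ∀ k d X → Infinite X → Infinite (stage-step k d X)
  stage-step-infinite k (yes (j , _)) X = refine-infinite X (P j) em
  stage-step-infinite k (no _)        X = id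

  stage-infinite : ∀ k → Infinite (stage k)
  stage-infinite zero    N = N , ℕ.≤-refl , tt
  stage-infinite (suc k)   = stage-step-infinite k em (stage k) (stage-infinite k)

  stage-step-⊆ : ∀ k d X {i} → stage-step k d X i → X i
  stage-step-⊆ k (no _) X = id
  stage-step-⊆ k (yes (j , _)) X = lemma em
    where
    lemma : ∀ d {i} → refine X (P j) d i → X i
    lemma (yes _) = proj₁
    lemma (no  _) = proj₁

  stage-antitone : ∀ k m {i} → stage (m + k) i → stage k i
  stage-antitone k zero    = id
  stage-antitone k (suc m) = stage-antitone k m ∘ stage-step-⊆ (m + k) em (stage (m + k))

  -- Membership in the filter generated by the stages.
  Eventually : Pred ℕ 0ℓ → Set
  Eventually X = ∃[ k ] (∀ {i} → stage k i → X i)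

  eventually-map : ∀ {X Y : Pred ℕ 0ℓ} → (∀ {i} → X i → Y i) → Eventually X → Eventually Y
  eventually-map f (k , X⊇) = k , f ∘ X⊇

  eventually-map₂ : ∀ {X Y Z : Pred ℕ 0ℓ} → (∀ {i} → X i → Y i → Z i) →
                    Eventually X → Eventually Y → Eventually Z
  eventually-map₂ f (k , X⊇) (m , Y⊇) =
    m + k , λ {i} p → f (X⊇ (stage-antitone k m p))
      (Y⊇ (stage-antitone m k (subst (λ l → stage l i) (ℕ.+-comm m k) p)))

  always : ∀ {X : Pred ℕ 0ℓ} → (∀ i → X i) → Eventually X
  always p = 0 , λ {i} _ → p i

  -- Non-principality: sets in the filter are unbounded because the stages are.
  from-some-point : ∀ {X : Pred ℕ 0ℓ} → Eventually X → ∀ N → ∃[ i ] N ≤ i × X i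
  from-some-point (k , X⊇) N = let i , N≤i , p = stage-infinite k N in i , N≤i , X⊇ p

  eventually-¬ : ∀ {X : Pred ℕ 0ℓ} → Eventually X → ¬ Eventually (λ i → ¬ X i)
  eventually-¬ p q = let _ , _ , r = from-some-point (eventually-map₂ (λ x ¬x → ¬x x) p q) 0 in r

  eventually-decides : ∀ j → Eventually (P j) ⊎ Eventually (λ i → ¬ P j i)
  eventually-decides j =
    [ (λ p → inj₁ (suc (index j) , p)) , (λ p → inj₂ (suc (index j) , p)) ]′ (step-decides (stage (index j)) em)
    where
    refine-decides : ∀ X d → (∀ {i} → refine X (P j) d i → P j i) ⊎ (∀ {i} → refine X (P j) d i → ¬ P j i)
    refine-decides X (yes _) = inj₁ proj₂
    refine-decides X (no  _) = inj₂ proj₂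
    step-decides : ∀ X d → (∀ {i} → stage-step (index j) d X i → P j i)
                         ⊎ (∀ {i} → stage-step (index j) d X i → ¬ P j i)
    step-decides X (no ¬p) = contradiction (j , refl) ¬p
    step-decides X (yes (j′ , eq)) with refl ← index-injective j′ j eq = refine-decides X em

least : ExcludedMiddle 0ℓ → ∀ {P : Pred ℕ 0ℓ} {n} → Acc ℕ._<_ n → P n → ∃[ m ] P m × (∀ {k} → P k → m ≤ k)
least em {P} {n} (acc rs) Pn with em {∃[ k ] k ℕ.< n × P k}
... | yes (k , k<n , Pk) = least em (rs k<n) Pk
... | no none = n , Pn , λ Pk → ℕ.≮⇒≥ (λ k<n → none (_ , k<n , Pk))

-- Without quotient types, classes are represented by their members of least index.
module Representatives {A : Set} (index : A → ℕ) (index-injective : Injective index)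
  {_∼_ : Rel A 0ℓ} (∼-isEquivalence : IsEquivalence _∼_) (em : ExcludedMiddle 0ℓ) where

  private module ∼ = IsEquivalence ∼-isEquivalence

  minimal : ∀ a → ∃[ m ] (∃[ b ] a ∼ b × index b ≡ m) × (∀ {k} → ∃[ b ] a ∼ b × index b ≡ k → m ≤ k)
  minimal a = least em (<-wellFounded (index a)) (a , ∼.refl , refl)

  rep : A → A
  rep = proj₁ ∘ proj₁ ∘ proj₂ ∘ minimal

  rep-∼ : ∀ a → a ∼ rep a
  rep-∼ a = proj₁ (proj₂ (proj₁ (proj₂ (minimal a))))

  rep-least : ∀ a {b} → a ∼ b → index (rep a) ≤ index b
  rep-least a {b} a∼b = subst (_≤ index b) (sym (proj₂ (proj₂ (proj₁ (proj₂ (minimal a))))))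
    (proj₂ (proj₂ (minimal a)) (b , a∼b , refl))

  rep-cong : ∀ {a b} → a ∼ b → rep a ≡ rep b
  rep-cong {a} {b} a∼b = index-injective _ _ (ℕ.≤-antisym
    (rep-least a (∼.trans a∼b (rep-∼ b))) (rep-least b (∼.trans (∼.sym a∼b) (rep-∼ a))))

  Class : Set
  Class = ∃[ a ] rep a ≡ a

  class : A → Class
  class a = rep a , rep-cong (∼.sym (rep-∼ a))

  class-≡ : ∀ {x y : Class} → proj₁ x ∼ proj₁ y → x ≡ y
  class-≡ {a , p} {b , q} a∼b with refl ← trans (sym p) (trans (rep-cong a∼b) q) = cong (a ,_) (uip p q)

module SkolemUltrapower {L : Language 0ℓ} (relational : ∀ {k} → ¬ Language.Function L k)
  (symbolTree : ∀ {k} → Language.Relation L k → Tree)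
  (symbolTree-injective : ∀ {k} → Injective (symbolTree {k}))
  (M : Structure L) (s : ℕ → Structure.Carrier M) (em : ExcludedMiddle 0ℓ) where

  open Encoding {L = L} relational symbolTree symbolTree-injective
  open Structure

  choose : Pred (Carrier M) 0ℓ → Carrier M
  choose P with em {∃ P}
  ... | yes (x , _) = x
  -- A default for unsatisfiable predicates; `choose-satisfies` never meets it.
  ... | no _ = nonempty M

  choose-satisfies : ∀ P → ∃ P → P (choose P)
  choose-satisfies P p with em {∃ P}
  ... | yes (_ , Px) = Px
  ... | no ¬p = contradiction p ¬p

  mutual
    value : Code → ℕ → Carrier M
    value diagonal      i = s i
    value (skolem φ cs) i = choose (λ x → M ⊨ φ [ x ∷ values cs i ])

    values : ∀ {n} → Vec Code n → ℕ → Vec (Carrier M) n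
    values []       i = []
    values (c ∷ cs) i = value c i ∷ values cs i

  Holds : Instance → Pred ℕ 0ℓ
  Holds (n , φ , cs) i = M ⊨ φ [ values cs i ]

  open Ultrafilter (code ∘ instanceTree) (code-∘-injective instanceTree-injective) Holds em public

  _∼_ : Rel Code 0ℓ
  c ∼ d = Eventually (λ i → value c i ≡ value d i)

  ∼-isEquivalence : IsEquivalence _∼_
  ∼-isEquivalence = record
    { refl = always (λ _ → refl) ; sym = eventually-map sym ; trans = eventually-map₂ trans }

  open Representatives (code ∘ codeTree) (code-∘-injective codeTree-injective) ∼-isEquivalence em public

  codes : ∀ {n} → Vec Class n → Vec Code n
  codes []       = []
  codes (x ∷ xs) = proj₁ x ∷ codes xs

  ultrapower : Structure L
  ultrapower .Carrier  = Class
  ultrapower .nonempty = class diagonal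
  ultrapower .⟦_⟧ᶠ f _ = contradiction f relational
  ultrapower .⟦_⟧ʳ r v = Eventually (λ i → ⟦ M ⟧ʳ r (values (codes v) i))

  lookup-values : ∀ {n} (v : Vec Class n) j i → lookup (values (codes v) i) j ≡ value (proj₁ (lookup v j)) i
  lookup-values (x ∷ v) zero    i = refl
  lookup-values (x ∷ v) (suc j) i = lookup-values v j i

  eval-values : ∀ {n} (t : Term L n) (v : Vec Class n) i →
                eval M t (values (codes v) i) ≡ value (proj₁ (eval ultrapower t v)) i
  eval-values (var j)   v i = lookup-values v j i
  eval-values (app f _) v i = contradiction f relational

  evals-values : ∀ {n k} (ts : Vec (Term L n) k) (v : Vec Class n) i →
                 evals M ts (values (codes v) i) ≡ values (codes (evals ultrapower ts v)) i
  evals-values []       v i = refl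
  evals-values (t ∷ ts) v i = cong₂ _∷_ (eval-values t v i) (evals-values ts v i)

  -- Skolem codes need not be representatives, while elements of the ultrapower are; this passes
  -- between the two.
  holds-class : ∀ {n} (φ : Formula L (suc n)) c (cs : Vec Code n) →
    Eventually (λ i → M ⊨ φ [ value c i ∷ values cs i ]) ⇔
    Eventually (λ i → M ⊨ φ [ value (rep c) i ∷ values cs i ])
  holds-class φ c cs = mk⇔
    (eventually-map₂ (λ {i} → subst (λ x → M ⊨ φ [ x ∷ values cs i ])) (rep-∼ c))
    (eventually-map₂ (λ {i} → subst (λ x → M ⊨ φ [ x ∷ values cs i ]) ∘ sym) (rep-∼ c))

  open Equivalence

  -- Łoś's theorem. Negation and disjunction use that the ultrafilter decides every instance. An
  -- existential is witnessed by its Skolem code; a universal that fails eventually is refuted by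
  -- the Skolem code of the negated body.
  łoś : ∀ {n} (φ : Formula L n) (v : Vec Class n) →
        (ultrapower ⊨ φ [ v ]) ⇔ Eventually (λ i → M ⊨ φ [ values (codes v) i ])
  łoś (t ≈′ u) v = mk⇔
    (λ p → always λ i → trans (eval-values t v i)
      (trans (cong (λ x → value (proj₁ x) i) p) (sym (eval-values u v i))))
    (class-≡ ∘ eventually-map λ {i} p → trans (sym (eval-values t v i)) (trans p (eval-values u v i)))
  łoś (rel r ts) v = mk⇔
    (eventually-map λ {i} → subst (⟦ M ⟧ʳ r) (sym (evals-values ts v i)))
    (eventually-map λ {i} → subst (⟦ M ⟧ʳ r) (evals-values ts v i))
  łoś (¬′ φ) v = mk⇔
    (λ ¬p → [ (λ q → contradiction (from (łoś φ v) q) ¬p) , id ]′ (eventually-decides (_ , φ , codes v)))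
    (λ q p → eventually-¬ (to (łoś φ v) p) q)
  łoś (φ ∧′ ψ) v = mk⇔
    (λ (p , q) → eventually-map₂ _,_ (to (łoś φ v) p) (to (łoś ψ v) q))
    (λ p → from (łoś φ v) (eventually-map proj₁ p) , from (łoś ψ v) (eventually-map proj₂ p))
  łoś (φ ∨′ ψ) v = mk⇔
    [ eventually-map inj₁ ∘ to (łoś φ v) , eventually-map inj₂ ∘ to (łoś ψ v) ]′
    (λ p → [ inj₁ ∘ from (łoś φ v)
           , (λ ¬φ → inj₂ (from (łoś ψ v)
               (eventually-map₂ (λ ¬x → [ (λ x → contradiction x ¬x) , id ]′) ¬φ p))) ]′
           (eventually-decides (_ , φ , codes v)))
  łoś {n} (∀′ φ) v = mk⇔
    (λ p → [ id , (λ ¬∀ → ⊥-elim (eventually-¬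
                (from (holds-class φ counterexample (codes v)) (to (łoś φ (class counterexample ∷ v)) (p _)))
                (eventually-map fails ¬∀))) ]′
           (eventually-decides (_ , ∀′ φ , codes v)))
    (λ p x → from (łoś φ (x ∷ v)) (eventually-map (λ q → q _) p))
    where
    counterexample : Code
    counterexample = skolem (¬′ φ) (codes v)
    fails : ∀ {i} → ¬ (∀ x → M ⊨ φ [ x ∷ values (codes v) i ]) →
            ¬ (M ⊨ φ [ value counterexample i ∷ values (codes v) i ])
    fails {i} ¬∀ = choose-satisfies _ (not-all em)
      where
      not-all : Dec (∃[ x ] ¬ (M ⊨ φ [ x ∷ values (codes v) i ])) → _
      not-all (yes p) = p
      not-all (no ¬p) = contradiction (λ x → all x em) ¬∀
        where
        all : ∀ x → Dec (M ⊨ φ [ x ∷ values (codes v) i ]) → M ⊨ φ [ x ∷ values (codes v) i ]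
        all x (yes q) = q
        all x (no ¬q) = contradiction (x , ¬q) ¬p
  łoś (∃′ φ) v = mk⇔
    (λ (x , p) → eventually-map (λ q → _ , q) (to (łoś φ (x ∷ v)) p))
    (λ p → class witness , from (łoś φ (class witness ∷ v))
      (to (holds-class φ witness (codes v)) (eventually-map (choose-satisfies _) p)))
    where
    witness : Code
    witness = skolem φ (codes v)

  ultrapower-≡ₑ : M ≡ₑ ultrapower
  ultrapower-≡ₑ φ = mk⇔ (λ p → from (łoś φ []) (always λ _ → p))
    (λ p → proj₂ (proj₂ (from-some-point (to (łoś φ []) p) 0)))

-- A generic colouring of the binary words.

-- Nodes of the binary tree, listed in order: w false… < w < w true…
Word : Set
Word = List Bool

infix 4 _≺_
data _≺_ : Rel Word 0ℓ where
  root-right : ∀ {v} → [] ≺ true ∷ v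
  left-root  : ∀ {u} → false ∷ u ≺ []
  left-right : ∀ {u v} → false ∷ u ≺ true ∷ v
  deeper     : ∀ {b u v} → u ≺ v → b ∷ u ≺ b ∷ v

≺-trans : ∀ {u v w} → u ≺ v → v ≺ w → u ≺ w
≺-trans root-right (deeper _)      = root-right
≺-trans left-root  root-right      = left-right
≺-trans left-right (deeper _)      = left-right
≺-trans (deeper _) left-root       = left-root
≺-trans (deeper _) left-right      = left-right
≺-trans (deeper p) (deeper q)      = deeper (≺-trans p q)

≺-irrefl : ∀ {u} → ¬ u ≺ u
≺-irrefl (deeper p) = ≺-irrefl p

≺-trichotomy : ∀ u v → u ≺ v ⊎ u ≡ v ⊎ v ≺ u
≺-trichotomy []          []          = inj₂ (inj₁ refl)
≺-trichotomy []          (true ∷ v)  = inj₁ root-right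
≺-trichotomy []          (false ∷ v) = inj₂ (inj₂ left-root)
≺-trichotomy (true ∷ u)  []          = inj₂ (inj₂ root-right)
≺-trichotomy (false ∷ u) []          = inj₁ left-root
≺-trichotomy (true ∷ u)  (false ∷ v) = inj₂ (inj₂ left-right)
≺-trichotomy (false ∷ u) (true ∷ v)  = inj₁ left-right
≺-trichotomy (true ∷ u)  (true ∷ v)  = [ inj₁ ∘ deeper , inj₂ ∘ [ inj₁ ∘ cong (true ∷_) , inj₂ ∘ deeper ]′ ]′ (≺-trichotomy u v)
≺-trichotomy (false ∷ u) (false ∷ v) = [ inj₁ ∘ deeper , inj₂ ∘ [ inj₁ ∘ cong (false ∷_) , inj₂ ∘ deeper ]′ ]′ (≺-trichotomy u v)

≺-right : ∀ u s → u ≺ (u ++ true ∷ []) ++ s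
≺-right []      s = root-right
≺-right (b ∷ u) s = deeper (≺-right u s)

≺-left : ∀ u s → (u ++ false ∷ []) ++ s ≺ u
≺-left []      s = left-root
≺-left (b ∷ u) s = deeper (≺-left u s)

-- Stronger than density: a whole subtree lies between, which leaves the end of the word free to
-- encode a colour.
subtree-between : ∀ {u v} → u ≺ v → ∃[ w ] (∀ s → u ≺ w ++ s × w ++ s ≺ v)
subtree-between {v = v} (root-right {v′}) = v ++ false ∷ [] , λ s → root-right , ≺-left v s
subtree-between {u} left-root  = u ++ true ∷ [] , λ s → ≺-right u s , left-root
subtree-between {u} left-right = u ++ true ∷ [] , λ s → ≺-right u s , left-right
subtree-between (deeper {b} p) = let w , between = subtree-between p in
  b ∷ w , λ s → deeper (proj₁ (between s)) , deeper (proj₂ (between s))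

strictTotalOrder : ∀ {A : Set} {_<_ : Rel A 0ℓ} → (∀ {x y z} → x < y → y < z → x < z) →
  (∀ {x} → ¬ x < x) → (∀ x y → x < y ⊎ x ≡ y ⊎ y < x) → IsStrictTotalOrder _≡_ _<_
strictTotalOrder {_<_ = _<_} <-trans <-irrefl trichotomy = isStrictTotalOrderᶜ record
  { isEquivalence = isEquivalence ; trans = <-trans ; compare = λ x y → compare (trichotomy x y) }
  where
  compare : ∀ {x y} → x < y ⊎ x ≡ y ⊎ y < x → Tri (x < y) (x ≡ y) (y < x)
  compare (inj₁ x<y)         = tri< x<y (λ { refl → <-irrefl x<y }) (λ y<x → <-irrefl (<-trans x<y y<x))
  compare (inj₂ (inj₁ refl)) = tri≈ <-irrefl refl <-irrefl
  compare (inj₂ (inj₂ y<x))  = tri> (λ x<y → <-irrefl (<-trans x<y y<x)) (λ { refl → <-irrefl y<x }) y<x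

≺-isDenseLinearOrder : IsDenseLinearOrder _≡_ _≺_
≺-isDenseLinearOrder = record
  { isStrictTotalOrder = strictTotalOrder ≺-trans ≺-irrefl ≺-trichotomy
  ; dense = λ p → let w , between = subtree-between p in w ++ [] , between [] }

-- The number of trailing falses is unconstrained within a subtree, hence takes
-- every value densely; being at most the length, it decodes to shorter words only.
trailing : ℕ → Word → ℕ
trailing k []          = k
trailing k (false ∷ w) = trailing (suc k) w
trailing k (true ∷ w)  = trailing 0 w

trailing-replicate : ∀ k n → trailing k (replicate n false) ≡ k + n
trailing-replicate k zero    = sym (ℕ.+-identityʳ k)
trailing-replicate k (suc n) = trans (trailing-replicate (suc k) n) (sym (ℕ.+-suc k n))

trailing-++ : ∀ k w n → trailing k (w ++ true ∷ replicate n false) ≡ n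
trailing-++ k []          n = trailing-replicate 0 n
trailing-++ k (false ∷ w) n = trailing-++ (suc k) w n
trailing-++ k (true ∷ w)  n = trailing-++ 0 w n

trailing-≤ : ∀ k w → trailing k w ≤ k + length w
trailing-≤ k []          = ℕ.≤-reflexive (sym (ℕ.+-identityʳ k))
trailing-≤ k (false ∷ w) = ℕ.≤-trans (trailing-≤ (suc k) w) (ℕ.≤-reflexive (sym (ℕ.+-suc k (length w))))
trailing-≤ k (true ∷ w)  = ℕ.≤-trans (trailing-≤ 0 w) (ℕ.≤-trans (ℕ.n≤1+n _) (ℕ.m≤n+m _ k))

boolTree : Bool → Tree
boolTree false = leaf
boolTree true  = node 0 leaf leaf

boolTree-injective : Injective boolTree
boolTree-injective false false _ = refl
boolTree-injective true  true  _ = refl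

wordsTree : List Word → Tree
wordsTree = listTree (listTree boolTree)

wordsTree-injective : Injective wordsTree
wordsTree-injective = listTree-injective (listTree-injective boolTree-injective)

module Colouring (em : ExcludedMiddle 0ℓ) where

  decode : ∀ k → Dec (∃[ ws ] code (wordsTree ws) ≡ k) → List Word
  decode k (yes (ws , _)) = ws
  decode k (no _)         = []

  decode-code : ∀ ws d → decode (code (wordsTree ws)) d ≡ ws
  decode-code ws (yes (_ , eq)) = code-∘-injective wordsTree-injective _ _ eq
  decode-code ws (no ¬p)        = contradiction (ws , refl) ¬p

  -- A word is no longer than its code, which is below the code of any list containing it.
  decode-shorter : ∀ k d {w} → w ∈ decode k d → length w ℕ.< k
  decode-shorter k (yes (ws , refl)) {w} w∈ =
    ℕ.≤-<-trans (length≤code boolTree w) (member-code (listTree boolTree) w∈)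

  colour : Word → List Word
  colour w = decode (trailing 0 w) em

  colour-wellFounded : WellFounded (λ x p → x ∈ colour p)
  colour-wellFounded = WellFounded.Subrelation.wellFounded
    (λ {x} {p} x∈ → ℕ.<-≤-trans (decode-shorter (trailing 0 p) em x∈) (trailing-≤ 0 p))
    (On.wellFounded length <-wellFounded)

  colour-dense : ∀ {a b} → a ≺ b → ∀ ws → ∃[ c ] a ≺ c × c ≺ b × colour c ≡ ws
  colour-dense a≺b ws with subtree-between a≺b
  ... | w , between = w ++ s , proj₁ (between s) , proj₂ (between s) ,
        subst (λ k → decode k em ≡ ws) (sym (trailing-++ 0 w n)) (decode-code ws em)
    where
    n = code (wordsTree ws)
    -- The `true` resets the count, so exactly `n` falses trail whatever `w` is.
    s = true ∷ replicate n false

-- Transfer of the order axioms.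

infixr 4 _⇒′_
-- Formulas have no implication, so it is encoded classically.
_⇒′_ : ∀ {L : Language ℓ} {n} → Formula L n → Formula L n → Formula L n
φ ⇒′ ψ = ¬′ (φ ∧′ ¬′ ψ)

⇒-intro : {P Q : Set} → (P → Q) → ¬ (P × ¬ Q)
⇒-intro f (p , ¬q) = ¬q (f p)

⇒-elim : ExcludedMiddle 0ℓ → {P Q : Set} → ¬ (P × ¬ Q) → P → Q
⇒-elim em ¬p p = decidable-stable em λ ¬q → ¬p (p , ¬q)

module Transfer {L : OrderedLanguage} (R : DLOExpansion L) (N : Structure (OrderedLanguage.language L))
  (R≡N : DLOExpansion.structure R ≡ₑ N) (em : ExcludedMiddle 0ℓ) where

  open OrderedLanguage L using (language)
  open DLOExpansion R using (isDenseLinearOrder; no-least; no-greatest)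
  open IsDenseLinearOrder isDenseLinearOrder using (irrefl; compare; dense) renaming (trans to <-trans)

  infix 7 _<′_
  _<′_ : ∀ {n} → Fin n → Fin n → Formula language n
  i <′ j = rel (OrderedLanguage.less L) (var i ∷ var j ∷ [])

  transfer : ∀ φ → DLOExpansion.structure R ⊨ φ [ [] ] → N ⊨ φ [ [] ]
  transfer φ = Equivalence.to (R≡N φ)

  irreflexive = transfer (∀′ (¬′ (# 0 <′ # 0))) λ _ → irrefl refl

  transitive = transfer (∀′ ∀′ ∀′ (# 2 <′ # 1 ∧′ # 1 <′ # 0 ⇒′ # 2 <′ # 0)) λ _ _ _ → ⇒-intro λ (p , q) → <-trans p q

  trichotomous = transfer (∀′ ∀′ (# 1 <′ # 0 ∨′ var (# 1) ≈′ var (# 0) ∨′ # 0 <′ # 1)) trichotomy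
    where
    trichotomy : ∀ x y → DLOExpansion._<_ R x y ⊎ x ≡ y ⊎ DLOExpansion._<_ R y x
    trichotomy x y with compare x y
    ... | tri< x<y _ _ = inj₁ x<y
    ... | tri≈ _ x≡y _ = inj₂ (inj₁ x≡y)
    ... | tri> _ _ y<x = inj₂ (inj₂ y<x)

  densely-ordered = transfer (∀′ ∀′ (# 1 <′ # 0 ⇒′ ∃′ (# 2 <′ # 0 ∧′ # 0 <′ # 1))) λ _ _ → ⇒-intro dense

  unbounded-below = transfer (∀′ ∃′ (# 0 <′ # 1)) no-least

  unbounded-above = transfer (∀′ ∃′ (# 1 <′ # 0)) no-greatest

  transferred : DLOExpansion L
  transferred = record
    { structure = N
    ; isDenseLinearOrder = record
      { isStrictTotalOrder = strictTotalOrder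
          (λ {x} {y} {z} p q → ⇒-elim em (transitive x y z) (p , q)) (λ {x} → irreflexive x) trichotomous
      ; dense = λ {x} {y} → ⇒-elim em (densely-ordered x y) }
    ; no-least = unbounded-below
    ; no-greatest = unbounded-above }

-- Closed fibres with long chains.

-- The pigeonhole step for `chain-bounded`: a point is covered by the remaining pieces unless it
-- shares a piece with `y`.
drop-piece : ∀ {A B : Set} (_∈ᵖ_ : A → B → Set) {ps y} → Any (y ∈ᵖ_) ps →
  ∃[ qs ] suc (length qs) ≡ length ps × qs ⊆ ps ×
    (∀ {z} → Any (z ∈ᵖ_) ps → Any (z ∈ᵖ_) qs ⊎ (∃[ p ] p ∈ ps × y ∈ᵖ p × z ∈ᵖ p))
drop-piece _∈ᵖ_ {p ∷ ps} (here y∈p) = ps , refl , there ,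
  λ { (here z∈p) → inj₂ (p , here refl , y∈p , z∈p) ; (there z∈) → inj₁ z∈ }
drop-piece _∈ᵖ_ {p ∷ ps} (there y∈) with drop-piece _∈ᵖ_ y∈
... | qs , len , qs⊆ps , rest = p ∷ qs , cong suc len ,
  (λ { (here eq) → here eq ; (there q) → there (qs⊆ps q) }) ,
  λ { (here z∈p) → inj₁ (here z∈p)
    ; (there z∈) → [ inj₁ ∘ there , (λ (p′ , p′∈ , y∈p′ , z∈p′) → inj₂ (p′ , there p′∈ , y∈p′ , z∈p′)) ]′ (rest z∈) }

member′ : ∀ {n} → Fin n → Fin n → Formula (OrderedLanguage.language colouredLanguage) n
member′ p x = rel member (var p ∷ var x ∷ [])

-- The fibre of d contains at least N points above x.
chain : ℕ → ∀ {n} → Fin n → Fin n → Formula (OrderedLanguage.language colouredLanguage) n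
chain zero    x d = var x ≈′ var x
chain (suc N) x d = ∃′ (rel less (var (suc x) ∷ var zero ∷ []) ∧′ member′ (suc d) zero ∧′ chain N zero (suc d))

module _ (N : DLOExpansion colouredLanguage) where

  open DLOExpansion N
  open Structure structure

  Fibre : Carrier → Pred Carrier 0ℓ
  Fibre p x = ⟦_⟧ʳ member (p ∷ x ∷ [])

  ClosedFibre : Carrier → Set
  ClosedFibre p = ∀ x → ¬ Fibre p x → ∃[ a ] ∃[ b ] a < x × x < b × (∀ z → a < z × z < b → ¬ Fibre p z)

  -- Empty interior, in a first-order form.
  ThinFibre : Carrier → Set
  ThinFibre p = ∀ u v → u < v → ∃[ w ] u < w × w < v × ¬ Fibre p w

  LongChains : Carrier → Set
  LongChains p = ∀ n → structure ⊨ ∃′ (chain n zero (suc zero)) [ p ∷ [] ]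

module InfiniteFibre (em : ExcludedMiddle 0ℓ) (N : DLOExpansion colouredLanguage)
  (δ : Structure.Carrier (DLOExpansion.structure N))
  (closed : ClosedFibre N δ) (thin : ThinFibre N δ) (chains : LongChains N δ) where

  open DLOExpansion N
  open Structure structure

  X : Pred Carrier 0ℓ
  X = Fibre N δ

  open Order _<_
  open Extrema _<_ using (<±-trans; [<]-injective; [_])
  open IsDenseLinearOrder isDenseLinearOrder using (irrefl) renaming (trans to <-trans)

  complement-open : Open {n = 1} (λ v → ¬ X (head v))
  complement-open (x ∷ []) x∉ with closed x x∉
  ... | a , b , a<x , x<b , avoids = [ a ] ∷ [] , [ b ] ∷ [] , (λ { zero → [ a<x ] , [ x<b ] }) ,
        λ { {y ∷ []} y∈ → avoids y ([<]-injective (proj₁ (y∈ zero)) , [<]-injective (proj₂ (y∈ zero))) }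

  complement-definable : Definable structure {n = 1} (λ v → ¬ X (head v))
  complement-definable = 1 , ¬′ member′ (# 1) (# 0) , δ ∷ [] , (λ { {x ∷ []} p → p }) , λ { {x ∷ []} p → p }

  -- The open core has a symbol for the open complement of the fibre; its negation defines the
  -- fibre.
  fibre-definable : Definable (openCore N) {n = 1} (X ∘ head)
  fibre-definable = 0 , ¬′ rel (_ , complement-definable , complement-open) (var zero ∷ []) , [] ,
    (λ { {x ∷ []} p ¬p → ¬p p }) , λ { {x ∷ []} → decidable-stable em }

  -- An interval with two points contains everything between them, hence a point outside the fibre.
  -- So a piece inside the fibre has at most one point.
  piece-thin : ∀ p → (∀ {w} → ⟦ p ⟧ w → X w) → ∀ {y z} → y < z → ⟦ p ⟧ y → ¬ ⟦ p ⟧ z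
  piece-thin (point a) _ y<z refl refl = irrefl refl y<z
  piece-thin (interval a b) p⊆ {y} {z} y<z (a<y , _) (_ , z<b) =
    let w , y<w , w<z , w∉ = thin y z y<z in
    w∉ (p⊆ (<±-trans <-trans a<y [ y<w ] , <±-trans <-trans [ w<z ] z<b))

  -- Each link of the chain uses up a piece: the one containing `y` contains no later point of the
  -- fibre, so the rest of the chain is covered by one piece fewer.
  chain-bounded : ∀ N ps {n} (x d : Fin n) v → lookup v d ≡ δ → structure ⊨ chain N x d [ v ] →
    (∀ {y} → lookup v x < y → X y → Any (λ p → ⟦ p ⟧ y) ps) →
    (∀ {p} → p ∈ ps → ∀ {w} → ⟦ p ⟧ w → X w) → N ≤ length ps
  chain-bounded zero    ps x d v eq _ covers p⊆ = z≤n
  chain-bounded (suc N) ps x d v eq (y , x<y , y∈ , rest) covers p⊆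
    with drop-piece (λ z p → ⟦ p ⟧ z) (covers x<y (subst (λ c → ⟦_⟧ʳ member (c ∷ y ∷ [])) eq y∈))
  ... | qs , len , qs⊆ps , split = subst (suc N ≤_) len (s≤s
    (chain-bounded N qs zero (suc d) (y ∷ v) eq rest
      (λ y<z z∈ → [ id , (λ (p , p∈ , y∈p , z∈p) → contradiction z∈p (piece-thin p (p⊆ p∈) y<z y∈p)) ]′
        (split (covers (<-trans x<y y<z) z∈)))
      (p⊆ ∘ qs⊆ps)))

  ¬oMinimalOpenCore : ¬ HasOMinimalOpenCore N
  ¬oMinimalOpenCore oMinimal =
    let ps , X⊆ , ⊆X = oMinimal X fibre-definable
        x , chained = chains (suc (length ps))
    in ℕ.1+n≰n (chain-bounded (suc (length ps)) ps zero (suc zero) (x ∷ δ ∷ []) refl chained (λ _ → X⊆)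
         λ p∈ w∈p → ⊆X (lose p∈ w∈p))

-- The two elementarily equivalent structures.

module Counterexample (em : ExcludedMiddle 0ℓ) where

  open Colouring em

  no-least : ∀ x → ∃[ y ] y ≺ x
  no-least x = _ , ≺-left x []

  no-greatest : ∀ x → ∃[ y ] x ≺ y
  no-greatest x = _ , ≺-right x []

  open Coloured ≺-isDenseLinearOrder no-least no-greatest [] colour colour-wellFounded colour-dense em
    using (colouredStructure; expansion; expansion-hasOMinimalOpenCore)
  open DenseOrder ≺-isDenseLinearOrder no-least no-greatest using (gap-above; gap-below)

  open OrderedLanguage colouredLanguage using (language)

  ascending : ℕ → Word → List Word
  ascending zero    x = []
  ascending (suc n) x = proj₁ (no-greatest x) ∷ ascending n (proj₁ (no-greatest x))

  -- The sequence that generates the ultrapower: its `i`-th colour has `i` increasing points. The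
  -- interval from `[]` to its chosen successor is an arbitrary place to find such a colour.
  parameter : ℕ → Word
  parameter i = proj₁ (colour-dense (proj₂ (no-greatest [])) (ascending i []))

  colour-parameter : ∀ i → colour (parameter i) ≡ ascending i []
  colour-parameter i = proj₂ (proj₂ (proj₂ (colour-dense (proj₂ (no-greatest [])) (ascending i []))))

  symbolTree : ∀ {k} → Symbol k → Tree
  symbolTree less   = leaf
  symbolTree member = node 0 leaf leaf

  symbolTree-injective : ∀ {k} → Injective (symbolTree {k})
  symbolTree-injective less   less   _ = refl
  symbolTree-injective member member _ = refl

  open SkolemUltrapower {L = language} (λ ()) symbolTree symbolTree-injective colouredStructure parameter em
  open Encoding {L = language} (λ ()) symbolTree symbolTree-injective using (diagonal)
  open Transfer expansion ultrapower ultrapower-≡ₑ em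

  chain-ascending : ∀ {N n} → N ≤ n → ∀ {m} (x d : Fin m) (v : Vec Word m) →
    ascending n (lookup v x) ⊆ colour (lookup v d) → colouredStructure ⊨ chain N x d [ v ]
  chain-ascending z≤n     x d v asc⊆ = refl
  chain-ascending (s≤s N≤n) x d v asc⊆ = proj₁ (no-greatest (lookup v x)) , proj₂ (no-greatest (lookup v x)) ,
    asc⊆ (here refl) , chain-ascending N≤n zero (suc d) (_ ∷ v) (asc⊆ ∘ there)

  δ : Class
  δ = class diagonal

  -- From position `N` on, the colours contain a chain of length `N`. The ultrafilter decides this
  -- instance, and deciding against it would make it fail at some such position.
  chains-exist : ∀ N → ultrapower ⊨ ∃′ (chain N zero (suc zero)) [ δ ∷ [] ]
  chains-exist N = Equivalence.from (łoś φ (δ ∷ [])) (Equivalence.to (holds-class φ diagonal [])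
    ([ id , (λ never → let i , N≤i , ¬φ = from-some-point never N in contradiction (at i N≤i) ¬φ) ]′
      (eventually-decides (1 , φ , diagonal ∷ []))))
    where
    φ = ∃′ (chain N zero (suc zero))
    at : ∀ i → N ≤ i → colouredStructure ⊨ φ [ parameter i ∷ [] ]
    at i N≤i = [] , chain-ascending N≤i zero (suc zero) ([] ∷ parameter i ∷ [])
      (subst (_ ∈_) (sym (colour-parameter i)))

  -- Colours are finite, so a point outside one has free intervals on both sides. Being first-order
  -- and uniform in `d`, this passes to every fibre of the ultrapower.
  fibre-closed = transfer (∀′ ∀′ (¬′ member′ (# 1) (# 0) ⇒′ ∃′ ∃′ (# 1 <′ # 2 ∧′ # 2 <′ # 0 ∧′
                   ∀′ (# 2 <′ # 0 ∧′ # 0 <′ # 1 ⇒′ ¬′ member′ (# 4) (# 0))))) λ d x → ⇒-intro λ x∉ →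
    let u , x<u , u< = gap-above x (colour d)
        l , l<x , <l = gap-below x (colour d)
    in l , u , l<x , x<u , λ z → ⇒-intro λ (l<z , z<u) z∈ → isolated {d} x∉ u< <l l<z z<u z∈ (≺-trichotomy z x)
    where
    isolated : ∀ {d x l u z} → x ∉ colour d → (∀ {e} → e ∈ colour d → x ≺ e → u ≺ e) →
               (∀ {e} → e ∈ colour d → e ≺ x → e ≺ l) → l ≺ z → z ≺ u → z ∈ colour d →
               ¬ (z ≺ x ⊎ z ≡ x ⊎ x ≺ z)
    isolated x∉ u< <l l<z z<u z∈ (inj₁ z<x)         = ≺-irrefl (≺-trans l<z (<l z∈ z<x))
    isolated x∉ u< <l l<z z<u z∈ (inj₂ (inj₁ refl)) = x∉ z∈
    isolated x∉ u< <l l<z z<u z∈ (inj₂ (inj₂ x<z))  = ≺-irrefl (≺-trans z<u (u< z∈ x<z))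

  fibre-thin = transfer (∀′ ∀′ ∀′ (# 1 <′ # 0 ⇒′ ∃′ (# 2 <′ # 0 ∧′ # 0 <′ # 1 ∧′ ¬′ member′ (# 3) (# 0))))
    λ d u v → ⇒-intro λ u<v →
    -- Listing `v` among the points to stay below puts `w` under `v`; and `w` is not in the colour,
    -- as it would lie below itself.
    let w , u<w , w< = gap-above u (v ∷ colour d) in
    w , u<w , w< (here refl) u<v , λ w∈ → ≺-irrefl (w< (there w∈) u<w)

  ¬elementary : ¬ Elementary HasOMinimalOpenCore
  ¬elementary elementary = InfiniteFibre.¬oMinimalOpenCore em transferred δ
    (λ x x∉ → let a , b , a<x , x<b , avoids = ⇒-elim em (fibre-closed δ x) x∉ in
      a , b , a<x , x<b , λ z → ⇒-elim em (avoids z))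
    (λ u v → ⇒-elim em (fibre-thin δ u v))
    chains-exist
    (elementary expansion transferred ultrapower-≡ₑ expansion-hasOMinimalOpenCore)

theorem1p1 : (∀ {ℓ} → ExcludedMiddle ℓ) → ¬ Elementary HasOMinimalOpenCore
theorem1p1 em = Counterexample.¬elementary em
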